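{- Let $n\ge2$ and let $\mathcal{L}$ be a maximal cross-free family of cuts in the $n$-vertex complete graph on $[n]$. Let $A$ be the $|\mathcal{L}|\times\binom n2$ matrix whose rows are the vectors $\chi(S)$ for $S\in\mathcal{L}$, let $z=A^T\mathbf{1}$ (so $z(e)$ is the number of cuts in $\mathcal{L}$ containing the pair $e$), and define $w(e)=2^{ -z(e)+1}$ for every pair $e$ of distinct elements of $[n]$. Then $G=([n],w)$ is a complete weighted graph with $\mathrm{cdim}(G)=2n-3$ and $\mathcal{M}(G)=\mathcal{L}$.
   Context: For $\emptyset\ne X\subsetneq[n]$ the cut $\Delta(X)$ is the set of unordered pairs with exactly one element in $X$ (shores $X$, $[n]\setminus X$); $\chi(S)\in\{0,1\}^{\binom n2}$ is its characteristic vector. Sets $X,Y$ cross if $X\cap Y$, $X\setminus Y$, $Y\setminus X$, $[n]\setminus(X\cup Y)$ are all nonempty; a family of distinct cuts is cross-free if no two have crossing shores, and maximal if no further cut can be added while keeping it cross-free. A complete weighted graph has $w(e)>0$ for every pair $e$. The weight of a cut is the sum of the weights of its pairs; $\mathcal{M}(G)$ is the set of minimum-weight cuts; $\mathrm{cdim}(G)=\dim\mathrm{span}\{\chi(S):S\in\mathcal{M}(G)\}$. -}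

module Defs where

open import Data.Nat as ℕ using (ℕ; zero; suc)
open import Data.Bool using (Bool; true; false; _xor_; if_then_else_)
open import Data.Fin using (Fin)
import Data.Fin
open import Data.Fin.Subset using (Subset; Nonempty; ∁; _∩_; _∪_)
open import Data.Vec using (Vec; lookup; []; _∷_)
open import Data.List using (List; []; _∷_)
open import Data.List.Relation.Unary.Any using (Any)
open import Data.List.Membership.Propositional using (_∈_)
import Data.Vec.Relation.Unary.All as VAll
open import Data.Rational as ℚ using (ℚ; 0ℚ; 1ℚ; ½)
open import Data.Product using (_×_; ∃-syntax; Σ-syntax)
open import Relation.Binary.PropositionalEquality using (_≡_)
open import Relation.Nullary using (¬_)

-- Vertices are Fin n (i.e. [n]); a shore is a subset X ⊆ [n].
-- Unordered pairs {i,j} are represented by (i , j) with i < j.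

ProperShore : ∀ {n} → Subset n → Set
ProperShore X = Nonempty X × Nonempty (∁ X)

inCut : ∀ {n} → Subset n → Fin n → Fin n → Bool
inCut X i j = lookup X i xor lookup X j

SameCut : ∀ {n} → Subset n → Subset n → Set
SameCut {n} X Y = ∀ (i j : Fin n) → i Data.Fin.< j → inCut X i j ≡ inCut Y i j

Cross : ∀ {n} → Subset n → Subset n → Set
Cross X Y = Nonempty (X ∩ Y) × Nonempty (X ∩ ∁ Y) × Nonempty (Y ∩ ∁ X) × Nonempty (∁ (X ∪ Y))

-- A family of cuts given by a list of shores (one shore per cut)
-- is a family of distinct cuts: all shores proper, no two entries give the same cut.
data DistinctCuts {n : ℕ} : List (Subset n) → Set where
  []  : DistinctCuts []
  _∷_ : ∀ {X L} → (ProperShore X × ¬ Any (SameCut X) L) → DistinctCuts L → DistinctCuts (X ∷ L)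

CrossFree : ∀ {n} → List (Subset n) → Set
CrossFree L = ∀ {X Y} → X ∈ L → Y ∈ L → ¬ Cross X Y

MaximalCrossFree : ∀ {n} → List (Subset n) → Set
MaximalCrossFree {n} L =
  DistinctCuts L × CrossFree L ×
  (∀ (Z : Subset n) → ProperShore Z → (∀ {X} → X ∈ L → ¬ Cross X Z) → Any (SameCut Z) L)

count : ∀ {n} → List (Subset n) → Fin n → Fin n → ℕ
count [] i j = 0
count (X ∷ L) i j = (if inCut X i j then 1 else 0) ℕ.+ count L i j

half^ : ℕ → ℚ
half^ zero = 1ℚ
half^ (suc k) = ½ ℚ.* half^ k

-- w(e) = 2^{-z(e)+1} = 2 · (1/2)^{z(e)}
weightFn : ∀ {n} → List (Subset n) → Fin n → Fin n → ℚ
weightFn L i j = (1ℚ ℚ.+ 1ℚ) ℚ.* half^ (count L i j)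

-- Weighted complete graph on [n]: weight function on ordered pairs, used for i < j only.
Weight : ℕ → Set
Weight n = Fin n → Fin n → ℚ

Complete : ∀ {n} → Weight n → Set
Complete {n} w = ∀ (i j : Fin n) → i Data.Fin.< j → 0ℚ ℚ.< w i j

sumPairs : ∀ {n} → (Fin n → Fin n → ℚ) → ℚ
sumPairs {zero} f = 0ℚ
sumPairs {suc n} f =
  sumOver (λ j → f Data.Fin.zero (Data.Fin.suc j)) ℚ.+ sumPairs {n} (λ i j → f (Data.Fin.suc i) (Data.Fin.suc j))
  where

  sumOver : ∀ {m} → (Fin m → ℚ) → ℚ
  sumOver {zero} g = 0ℚ
  sumOver {suc m} g = g Data.Fin.zero ℚ.+ sumOver (λ k → g (Data.Fin.suc k))

χ : ∀ {n} → Subset n → Fin n → Fin n → ℚ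
χ X i j = if inCut X i j then 1ℚ else 0ℚ

cutWeight : ∀ {n} → Weight n → Subset n → ℚ
cutWeight w X = sumPairs (λ i j → χ X i j ℚ.* w i j)

IsMinCut : ∀ {n} → Weight n → Subset n → Set
IsMinCut {n} w X = ProperShore X × (∀ (Y : Subset n) → ProperShore Y → cutWeight w X ℚ.≤ cutWeight w Y)

lincomb : ∀ {n k} → Vec ℚ k → Vec (Subset n) k → Fin n → Fin n → ℚ
lincomb [] [] i j = 0ℚ
lincomb (c ∷ cs) (X ∷ Xs) i j = c ℚ.* χ X i j ℚ.+ lincomb cs Xs i j

LinIndep : ∀ {n k} → Vec (Subset n) k → Set
LinIndep {n} {k} Xs = ∀ (cs : Vec ℚ k) →
  (∀ (i j : Fin n) → i Data.Fin.< j → lincomb cs Xs i j ≡ 0ℚ) → VAll.All (_≡ 0ℚ) cs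

-- cdim(G) = d : the span of {χ(S) : S ∈ M(G)} has dimension d,
-- i.e. d is the maximum size of a linearly independent family of such vectors.
CDim : ∀ {n} → Weight n → ℕ → Set
CDim {n} w d =
  (Σ[ Xs ∈ Vec (Subset n) d ] (VAll.All (IsMinCut w) Xs × LinIndep Xs)) ×
  (∀ (k : ℕ) (Xs : Vec (Subset n) k) → VAll.All (IsMinCut w) Xs → LinIndep Xs → k ℕ.≤ d)

MinCutsAre : ∀ {n} → Weight n → List (Subset n) → Set
MinCutsAre {n} w L = ∀ (X : Subset n) → ProperShore X → ((IsMinCut w X → Any (SameCut X) L) × (Any (SameCut X) L → IsMinCut w X))

{-# OPTIONS --safe #-}

-- Take the vertex zero as a root and represent each cut by its side away from the root. A maximal
-- cross-free family becomes a maximal laminar family on the other vertices: the nodes of a full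
-- binary tree whose leaves are these vertices. Let the mass of a set x of leaves below a node be the
-- total weight of its pairs with the root, counting only the cuts below that node, and let its flow
-- be the total weight of the pairs it separates there. At a node with children of masses a, b and
-- flows f, g, the mass is (a + b) / 2 and the flow is f + g + (a (1 - b) + b (1 - a)) / 2, so by
-- induction both flow >= mass and flow + mass >= 1 hold unless x is empty or full. The weight of the
-- cut of x is flow + mass at the top; it is at least 1 for nonempty x, with equality only for nodes.
-- If a linear combination of the node cuts vanishes, then for all leaves i, j the coefficients of
-- the nodes containing both sum to 0. Applying this at the lowest common ancestor of i and j, from
-- the top down, kills each coefficient; and a binary tree with n - 1 leaves has 2n - 3 nodes.
module Submission where

open import Defs
open import Data.Nat using (ℕ; _≤_; _*_; _∸_)
open import Data.Fin.Subset using (Subset)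
open import Data.List using (List)
open import Data.Product using (_×_)

open import Data.Nat using (zero; suc; s≤s; z≤n)
import Data.Nat as ℕ
import Data.Nat.Properties as ℕₚ
open import Data.Bool using (Bool; true; false; not; _∧_; _xor_; if_then_else_)
open import Data.Bool.Properties as Boolₚ using (xor-comm)
open import Data.Fin as Fin using (Fin; zero; suc)
import Data.Fin.Properties as Finₚ
open import Data.Fin.Subset using (_∈_; _∉_; _⊆_; _⊂_; _∩_; _∪_; ∁; ⊤; ⊥; ⁅_⁆; ∣_∣; Nonempty)
import Data.Fin.Subset.Properties as Sub
open import Data.Fin.Subset.Induction using (⊂-wellFounded; Acc; acc)
open import Data.Vec as Vec using (Vec; []; _∷_; lookup; tabulate; toList; here; there)
import Data.Vec.Properties as Vecₚ
import Data.Vec.Relation.Unary.All as VAll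
import Data.Vec.Relation.Unary.All.Properties as VAllₚ
import Data.Vec.Relation.Unary.AllPairs as VAllPairs
import Data.Vec.Relation.Unary.Any as VAny
import Data.Vec.Relation.Unary.Any.Properties as VAnyₚ
import Data.Vec.Relation.Unary.Unique.Propositional as VUnique
import Data.Vec.Relation.Unary.Unique.Propositional.Properties as VUniqueₚ
import Data.Vec.Membership.Propositional as VMem
import Data.Vec.Membership.Propositional.Properties as VMemₚ
open import Data.List as List using ([]; _∷_)
import Data.List.Properties as Listₚ
open import Data.List.Relation.Unary.Any as Any using (Any; here; there)
import Data.List.Relation.Unary.Any.Properties as Anyₚ
import Data.List.Relation.Unary.All.Properties as Allₚ
import Data.List.Relation.Unary.All as All
import Data.List.Relation.Unary.AllPairs as LAllPairs
open import Data.List.Membership.Propositional using () renaming (_∈_ to _∈ₗ_)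
import Data.List.Membership.Propositional.Properties as Memₚ
open import Data.List.Membership.Propositional.Properties.WithK using (unique∧set⇒bag)
open import Data.List.Relation.Binary.BagAndSetEquality using (∼bag⇒↭)
open import Data.List.Relation.Binary.Permutation.Propositional as Perm using (_↭_)
import Data.List.Relation.Binary.Permutation.Propositional.Properties as Permₚ
open import Data.List.Relation.Unary.Unique.Propositional using (Unique)
import Data.List.Extrema ℕₚ.≤-totalOrder as Extrema
open import Data.Rational as ℚ using (ℚ; 0ℚ; 1ℚ; ½; _+_; _-_; -_; _<_) renaming (_*_ to _·_)
import Data.Rational.Properties as ℚₚ
open import Data.Rational.Solver using (module +-*-Solver)
open import Algebra.Properties.CommutativeSemigroup ℕₚ.+-commutativeSemigroup as Comm using ()
open import Algebra.Bundles using (CommutativeRing)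
open import Algebra.Properties.Semiring.Sum (CommutativeRing.semiring ℚₚ.+-*-commutativeRing)
  using (sum; sum-cong-≗; ∑-distrib-+; *-distribˡ-sum; *-distribʳ-sum)
open import Data.Product using (Σ-syntax; ∃; ∃-syntax; _,_; proj₁; proj₂)
open import Data.Sum using (_⊎_; inj₁; inj₂; [_,_]′)
open import Data.Empty using (⊥-elim)
open import Function using (_∘_; mk⇔)
open import Relation.Nullary using (¬_; yes; no; contradiction)
open import Relation.Binary.PropositionalEquality

open +-*-Solver using (solve; _:=_; _:+_; _:*_; _:-_; :-_; con)

-- Sums over pairs

-- The row sum used by sumPairs is local to Defs and cannot be named here. Unification recovers it:
-- the metavariable below is solved by the refl of sumPairs-row, where with-abstraction has turned
-- all the arguments of the local function into distinct variables.
sumPairs-split : ∀ {n} (f : Fin (suc (suc n)) → Fin (suc (suc n)) → ℚ) →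
  Σ[ s ∈ ℚ ] sumPairs f ≡ (f zero (suc zero) + s) + sumPairs (λ i j → f (suc i) (suc j))
sumPairs-split f = _ , refl

mutual
  rowSum : ∀ N (f : Fin (suc N) → Fin (suc N) → ℚ) m → (Fin m → ℚ) → ℚ
  rowSum = _

  sumPairs-row : ∀ {n} (f : Fin (suc (suc n)) → Fin (suc (suc n)) → ℚ) →
    proj₁ (sumPairs-split f) ≡ rowSum (suc n) f n (λ k → f zero (suc (suc k)))
  sumPairs-row {n} f with suc n | f | (λ (k : Fin n) → f zero (suc (suc k)))
  ... | N | f′ | g = refl {x = rowSum N f′ n g}

rowSum≡sum : ∀ N f m g → rowSum N f m g ≡ sum g
rowSum≡sum N f zero    g = refl
rowSum≡sum N f (suc m) g = cong (g zero +_) (rowSum≡sum N f m (g ∘ suc))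

sumPairs-suc : ∀ {n} (f : Fin (suc n) → Fin (suc n) → ℚ) →
  sumPairs f ≡ sum (λ j → f zero (suc j)) + sumPairs (λ i j → f (suc i) (suc j))
sumPairs-suc {n} f = cong (_+ sumPairs (λ i j → f (suc i) (suc j))) (rowSum≡sum n f n _)

sumPairs-cong : ∀ {n} {f g : Fin n → Fin n → ℚ} → (∀ i j → f i j ≡ g i j) → sumPairs f ≡ sumPairs g
sumPairs-cong {zero} eq = refl
sumPairs-cong {suc n} {f} {g} eq = begin
  sumPairs f ≡⟨ sumPairs-suc f ⟩
  sum (λ j → f zero (suc j)) + sumPairs (λ i j → f (suc i) (suc j))
    ≡⟨ cong₂ _+_ (sum-cong-≗ (λ j → eq zero (suc j))) (sumPairs-cong (λ i j → eq (suc i) (suc j))) ⟩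
  sum (λ j → g zero (suc j)) + sumPairs (λ i j → g (suc i) (suc j)) ≡⟨ sumPairs-suc g ⟨
  sumPairs g ∎
  where open ≡-Reasoning

⟦_⟧ : Bool → ℚ
⟦ b ⟧ = if b then 1ℚ else 0ℚ

sum-zero : ∀ {n} (g : Fin n → ℚ) → (∀ i → g i ≡ 0ℚ) → sum g ≡ 0ℚ
sum-zero {zero}  g eq = refl
sum-zero {suc n} g eq rewrite eq zero | sum-zero (g ∘ suc) (eq ∘ suc) = refl

sum-⁅⁆ : ∀ {n} (i : Fin n) (g : Fin n → ℚ) → sum (λ j → ⟦ lookup ⁅ i ⁆ j ⟧ · g j) ≡ g i
sum-⁅⁆ zero g = begin
  1ℚ · g zero + sum (λ j → ⟦ lookup ⊥ j ⟧ · g (suc j))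
    ≡⟨ cong₂ _+_ (ℚₚ.*-identityˡ (g zero)) (sum-zero _ (λ j →
         trans (cong (λ b → ⟦ b ⟧ · g (suc j)) (Vecₚ.lookup-replicate j false)) (ℚₚ.*-zeroˡ (g (suc j))))) ⟩
  g zero + 0ℚ ≡⟨ ℚₚ.+-identityʳ _ ⟩
  g zero ∎
  where open ≡-Reasoning
sum-⁅⁆ (suc i) g = trans (cong₂ _+_ (ℚₚ.*-zeroˡ (g zero)) (sum-⁅⁆ i (g ∘ suc))) (ℚₚ.+-identityˡ _)

-- A pair in the cut of x has exactly one orientation that leaves x.
sumPairs-cut : ∀ {n} (x : Fin n → Bool) (u : Fin n → Fin n → ℚ) → (∀ i j → u i j ≡ u j i) →
  sumPairs (λ i j → ⟦ x i xor x j ⟧ · u i j) ≡ sum (λ i → sum (λ j → ⟦ x i ⟧ · (⟦ not (x j) ⟧ · u i j)))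
sumPairs-cut {zero}  x u u-sym = refl
sumPairs-cut {suc n} x u u-sym = begin
  sumPairs (λ i j → ⟦ x i xor x j ⟧ · u i j) ≡⟨ sumPairs-suc {n} (λ i j → ⟦ x i xor x j ⟧ · u i j) ⟩
  sum (λ j → ⟦ x zero xor x (suc j) ⟧ · u zero (suc j)) + sumPairs (λ i j → ⟦ x (suc i) xor x (suc j) ⟧ · u (suc i) (suc j))
    ≡⟨ cong₂ _+_ (trans (sum-cong-≗ split) (∑-distrib-+ (λ j → e zero (suc j)) (λ i → e (suc i) zero)))
         (sumPairs-cut (x ∘ suc) (λ i j → u (suc i) (suc j)) (λ i j → u-sym (suc i) (suc j))) ⟩
  -- The inserted zero is the diagonal entry `e zero zero`, which vanishes because no vertex is both
  -- inside and outside `x`.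
  (r + c) + t ≡⟨ solve 3 (λ r c t → (r :+ c) :+ t := (con 0ℚ :+ r) :+ (c :+ t)) refl r c t ⟩
  (0ℚ + r) + (c + t)
    ≡⟨ cong₂ (λ a b → (a + r) + b) (sym (diag (x zero) (u zero zero))) (sym (∑-distrib-+ (λ i → e (suc i) zero) (λ i → sum (λ j → e (suc i) (suc j))))) ⟩
  sum (λ i → sum (e i)) ∎
  where
  open ≡-Reasoning
  e : Fin (suc n) → Fin (suc n) → ℚ
  e i j = ⟦ x i ⟧ · (⟦ not (x j) ⟧ · u i j)
  r = sum (λ j → e zero (suc j))
  c = sum (λ i → e (suc i) zero)
  t = sum (λ i → sum (λ j → e (suc i) (suc j)))
  orient : ∀ a b v → ⟦ a xor b ⟧ · v ≡ ⟦ a ⟧ · (⟦ not b ⟧ · v) + ⟦ b ⟧ · (⟦ not a ⟧ · v)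
  orient true  true  = solve 1 (λ v → con 0ℚ :* v := con 1ℚ :* (con 0ℚ :* v) :+ con 1ℚ :* (con 0ℚ :* v)) refl
  orient true  false = solve 1 (λ v → con 1ℚ :* v := con 1ℚ :* (con 1ℚ :* v) :+ con 0ℚ :* (con 0ℚ :* v)) refl
  orient false true  = solve 1 (λ v → con 1ℚ :* v := con 0ℚ :* (con 0ℚ :* v) :+ con 1ℚ :* (con 1ℚ :* v)) refl
  orient false false = solve 1 (λ v → con 0ℚ :* v := con 0ℚ :* (con 1ℚ :* v) :+ con 0ℚ :* (con 1ℚ :* v)) refl
  diag : ∀ a v → ⟦ a ⟧ · (⟦ not a ⟧ · v) ≡ 0ℚ
  diag true  = solve 1 (λ v → con 1ℚ :* (con 0ℚ :* v) := con 0ℚ) refl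
  diag false v = ℚₚ.*-zeroˡ (1ℚ · v)
  split : ∀ j → ⟦ x zero xor x (suc j) ⟧ · u zero (suc j) ≡ e zero (suc j) + e (suc j) zero
  split j rewrite u-sym (suc j) zero = orient (x zero) (x (suc j)) (u zero (suc j))

-- Maximal laminar families are binary trees

-- The possible memberships of one vertex in a set and in its two parts. With the Booleans as
-- indices, matching on a `Split` settles all three lookups at once.
data Split : Bool → Bool → Bool → Set where
  out   : Split false false false
  left  : Split true true false
  right : Split true false true

split-left : ∀ {s a b} → Split s a b → a ≡ true → s ≡ true
split-left left refl = refl

split-right : ∀ {s a b} → Split s a b → b ≡ true → s ≡ true
split-right right refl = refl

split-disjointˡ : ∀ {s a b} → Split s a b → a ≡ true → b ≡ false
split-disjointˡ left refl = refl

split-disjointʳ : ∀ {s a b} → Split s a b → b ≡ true → a ≡ false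
split-disjointʳ right refl = refl

-- A record, so that the three sets can be inferred from a proof; the bare pointwise function type
-- would not determine them.
record Partition {m : ℕ} (S A B : Subset m) : Set where
  constructor mkPartition
  field at : ∀ i → Split (lookup S i) (lookup A i) (lookup B i)

open Partition

-- Full binary trees indexed by their leaf sets. Children are nonempty automatically, since every
-- tree ends in leaves.
data Tree {m : ℕ} : Subset m → Set where
  leaf : ∀ i → Tree ⁅ i ⁆
  node : ∀ {S A B} → Partition S A B → Tree A → Tree B → Tree S

size : ∀ {m} {S : Subset m} → Tree S → ℕ
size (leaf i)     = 1
size (node _ l r) = suc (size l ℕ.+ size r)

-- A vector rather than a list, so that a coefficient vector of the same length can be split along
-- the children.
nodes : ∀ {m} {S : Subset m} (T : Tree S) → Vec (Subset m) (size T)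
nodes (leaf i)         = ⁅ i ⁆ ∷ []
nodes (node {S} _ l r) = S ∷ (nodes l Vec.++ nodes r)

infix 4 _∈ᵀ_
_∈ᵀ_ : ∀ {m} {S : Subset m} → Subset m → Tree S → Set
Z ∈ᵀ T = Z ∈ₗ toList (nodes T)

root∈ : ∀ {m} {S : Subset m} (T : Tree S) → S ∈ᵀ T
root∈ (leaf i)     = here refl
root∈ (node _ l r) = here refl

module _ {m : ℕ} {S A B Z : Subset m} (p : Partition S A B) (l : Tree A) (r : Tree B) where

  left∈ : Z ∈ᵀ l → Z ∈ᵀ node p l r
  left∈ Z∈l = there (subst (Z ∈ₗ_) (sym (Vecₚ.toList-++ (nodes l) (nodes r))) (Memₚ.∈-++⁺ˡ Z∈l))

  right∈ : Z ∈ᵀ r → Z ∈ᵀ node p l r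
  right∈ Z∈r = there (subst (Z ∈ₗ_) (sym (Vecₚ.toList-++ (nodes l) (nodes r))) (Memₚ.∈-++⁺ʳ (toList (nodes l)) Z∈r))

  node∈⁻ : Z ∈ᵀ node p l r → Z ≡ S ⊎ Z ∈ᵀ l ⊎ Z ∈ᵀ r
  node∈⁻ (here Z≡S)  = inj₁ Z≡S
  node∈⁻ (there Z∈) = inj₂ (Memₚ.∈-++⁻ (toList (nodes l)) (subst (Z ∈ₗ_) (Vecₚ.toList-++ (nodes l) (nodes r)) Z∈))

module _ {m : ℕ} {S A B : Subset m} (p : Partition S A B) where

  left⊆ : A ⊆ S
  left⊆ {i} i∈A = Vecₚ.lookup⇒[]= i S (split-left (at p i) (Vecₚ.[]=⇒lookup i∈A))

  right⊆ : B ⊆ S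
  right⊆ {i} i∈B = Vecₚ.lookup⇒[]= i S (split-right (at p i) (Vecₚ.[]=⇒lookup i∈B))

∈ᵀ⇒⊆ : ∀ {m} {S Z : Subset m} (T : Tree S) → Z ∈ᵀ T → Z ⊆ S
∈ᵀ⇒⊆ (leaf i) (here refl) = λ x → x
∈ᵀ⇒⊆ (node p l r) Z∈ with node∈⁻ p l r Z∈
... | inj₁ refl        = λ x → x
... | inj₂ (inj₁ Z∈l) = left⊆ p ∘ ∈ᵀ⇒⊆ l Z∈l
... | inj₂ (inj₂ Z∈r) = right⊆ p ∘ ∈ᵀ⇒⊆ r Z∈r

tree-nonempty : ∀ {m} {S : Subset m} → Tree S → Nonempty S
tree-nonempty (leaf i)     = i , Sub.x∈⁅x⁆ i
tree-nonempty (node p l r) with tree-nonempty l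
... | i , i∈A = i , left⊆ p i∈A

∈ᵀ⇒nonempty : ∀ {m} {S Z : Subset m} (T : Tree S) → Z ∈ᵀ T → Nonempty Z
∈ᵀ⇒nonempty T@(leaf i) (here refl) = tree-nonempty T
∈ᵀ⇒nonempty T@(node p l r) Z∈ with node∈⁻ p l r Z∈
... | inj₁ refl       = tree-nonempty T
... | inj₂ (inj₁ Z∈l) = ∈ᵀ⇒nonempty l Z∈l
... | inj₂ (inj₂ Z∈r) = ∈ᵀ⇒nonempty r Z∈r

partition-card : ∀ {m} (S A B : Subset m) → Partition S A B → ∣ S ∣ ≡ ∣ A ∣ ℕ.+ ∣ B ∣
partition-card [] [] [] p = refl
partition-card (_ ∷ S) (_ ∷ A) (_ ∷ B) p with at p zero
... | out   = partition-card S A B (mkPartition (at p ∘ suc))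
... | left  = cong suc (partition-card S A B (mkPartition (at p ∘ suc)))
... | right = trans (cong suc (partition-card S A B (mkPartition (at p ∘ suc)))) (sym (ℕₚ.+-suc ∣ A ∣ ∣ B ∣))

-- One more than the number of nodes is additive over the two children, just as the number of leaves
-- is, so a plain induction works without subtraction.
suc-size : ∀ {m} {S : Subset m} (T : Tree S) → suc (size T) ≡ ∣ S ∣ ℕ.+ ∣ S ∣
suc-size (leaf i) rewrite Sub.∣⁅x⁆∣≡1 i = refl
suc-size (node {S} {A} {B} p l r) = begin
  suc (suc (size l ℕ.+ size r))             ≡⟨ cong suc (ℕₚ.+-suc (size l) (size r)) ⟨
  suc (size l) ℕ.+ suc (size r)             ≡⟨ cong₂ ℕ._+_ (suc-size l) (suc-size r) ⟩
  (∣ A ∣ ℕ.+ ∣ A ∣) ℕ.+ (∣ B ∣ ℕ.+ ∣ B ∣)   ≡⟨ ℕ-solve ∣ A ∣ ∣ B ∣ ⟩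
  (∣ A ∣ ℕ.+ ∣ B ∣) ℕ.+ (∣ A ∣ ℕ.+ ∣ B ∣)   ≡⟨ cong (λ k → k ℕ.+ k) (partition-card S A B p) ⟨
  ∣ S ∣ ℕ.+ ∣ S ∣ ∎
  where
  open ≡-Reasoning
  ℕ-solve : ∀ a b → (a ℕ.+ a) ℕ.+ (b ℕ.+ b) ≡ (a ℕ.+ b) ℕ.+ (a ℕ.+ b)
  ℕ-solve a b = Comm.interchange a a b b

⊆∧⊄⇒⊇ : ∀ {m} {A B : Subset m} → A ⊆ B → ¬ A ⊂ B → B ⊆ A
⊆∧⊄⇒⊇ {A = A} A⊆B A⊄B {x} x∈B with x Sub.∈? A
... | yes x∈A = x∈A
... | no  x∉A = contradiction ((λ {y} → A⊆B {y}) , x , x∈B , x∉A) A⊄B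

Laminar : ∀ {m} → Subset m → Subset m → Set
Laminar A B = (∀ {i} → i ∈ A → i ∉ B) ⊎ A ⊆ B ⊎ B ⊆ A

-- Maximality can demand literal membership here: a cut has two shores, but only one side away from
-- the root.
record MaximalLaminar {m : ℕ} (F : List (Subset m)) : Set where
  field
    nonempty : ∀ {A} → A ∈ₗ F → Nonempty A
    laminar  : ∀ {A B} → A ∈ₗ F → B ∈ₗ F → Laminar A B
    maximal  : ∀ {Z} → Nonempty Z → (∀ {A} → A ∈ₗ F → Laminar A Z) → Z ∈ₗ F

  -- A singleton is laminar with every set, so maximality forces it into the family. These are the
  -- future leaves.
  ⁅⁆∈ : ∀ i → ⁅ i ⁆ ∈ₗ F
  ⁅⁆∈ i = maximal (i , Sub.x∈⁅x⁆ i) laminar-⁅⁆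
    where
    laminar-⁅⁆ : ∀ {A} → A ∈ₗ F → Laminar A ⁅ i ⁆
    laminar-⁅⁆ {A} _ with i Sub.∈? A
    ... | yes i∈A = inj₂ (inj₂ λ x∈ → subst (_∈ A) (sym (Sub.x∈⁅y⁆⇒x≡y i x∈)) i∈A)
    ... | no  i∉A = inj₁ λ x∈A x∈ → i∉A (subst (_∈ A) (Sub.x∈⁅y⁆⇒x≡y i x∈) x∈A)

  -- Among the members strictly inside `S`, one of largest cardinality cannot be strictly contained
  -- in another.
  greatest-below : ∀ {S Z} → Z ∈ₗ F → Z ⊂ S →
    ∃[ A ] A ∈ₗ F × A ⊂ S × (∀ {B} → B ∈ₗ F → B ⊂ S → A ⊆ B → B ⊆ A)
  greatest-below {S} {Z} Z∈F Z⊂S = A , proj₁ A-below , proj₂ A-below , A-greatest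
    where
    G = List.filter (Sub._⊂? S) F
    -- The default value `Z` is itself a candidate, so the chosen set is a member strictly inside
    -- `S` in every case.
    A = Extrema.argmax ∣_∣ Z G
    A-below : A ∈ₗ F × A ⊂ S
    A-below = Extrema.argmax-all ∣_∣ {P = λ B → B ∈ₗ F × B ⊂ S} (Z∈F , Z⊂S)
      (All.tabulate (Memₚ.∈-filter⁻ (Sub._⊂? S)))
    A-greatest : ∀ {B} → B ∈ₗ F → B ⊂ S → A ⊆ B → B ⊆ A
    A-greatest {B} B∈F B⊂S A⊆B {x} x∈B with x Sub.∈? A
    ... | yes x∈A = x∈A
    ... | no  x∉A = contradiction
      (All.lookup (Extrema.f[xs]≤f[argmax] Z G) (Memₚ.∈-filter⁺ (Sub._⊂? S) B∈F B⊂S))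
      (ℕₚ.<⇒≱ (Sub.p⊂q⇒∣p∣<∣q∣ ((λ {y} → A⊆B {y}) , x , x∈B , x∉A)))

  module _ {S A} (S∈F : S ∈ₗ F) (A∈F : A ∈ₗ F) (A⊂S : A ⊂ S)
           (A-greatest : ∀ {B} → B ∈ₗ F → B ⊂ S → A ⊆ B → B ⊆ A) where

    rest : Subset m
    rest = S ∩ ∁ A

    ∈rest : ∀ {i} → i ∈ S → i ∉ A → i ∈ rest
    ∈rest i∈S i∉A = Sub.x∈p∩q⁺ (i∈S , Sub.x∉p⇒x∈∁p i∉A)

    rest⊆ : rest ⊆ S
    rest⊆ = Sub.p∩q⊆p S (∁ A)

    rest-disjoint : ∀ {i} → i ∈ rest → i ∉ A
    rest-disjoint i∈ = Sub.x∈∁p⇒x∉p (proj₂ (Sub.x∈p∩q⁻ S (∁ A) i∈))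

    rest⊂ : rest ⊂ S
    rest⊂ with nonempty A∈F
    ... | i , i∈A = rest⊆ , i , proj₁ A⊂S i∈A , λ i∈ → rest-disjoint i∈ i∈A

    partition : Partition S A rest
    partition .at i rewrite Vecₚ.lookup-zipWith _∧_ i S (∁ A) | Vecₚ.lookup-map i not A
      with lookup S i in eqS | lookup A i in eqA
    ... | true  | true  = left
    ... | true  | false = right
    ... | false | false = out
    ... | false | true  = contradiction
      (trans (sym eqS) (Vecₚ.[]=⇒lookup (proj₁ A⊂S (Vecₚ.lookup⇒[]= i A eqA)))) λ ()

    -- A proper `Z` disjoint from `A` falls into `rest`; one that contains `A` is forced back into
    -- `A` by the choice of `A`.
    below : ∀ {Z} → Z ∈ₗ F → Z ⊆ S → Z ≡ S ⊎ Z ⊆ A ⊎ Z ⊆ rest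
    below {Z} Z∈F Z⊆S with Z Sub.⊂? S
    ... | no  Z⊄S = inj₁ (Sub.⊆-antisym Z⊆S (⊆∧⊄⇒⊇ Z⊆S Z⊄S))
    ... | yes Z⊂S with laminar Z∈F A∈F
    ...   | inj₁ disj       = inj₂ (inj₂ λ x∈Z → ∈rest (Z⊆S x∈Z) (disj x∈Z))
    ...   | inj₂ (inj₁ Z⊆A) = inj₂ (inj₁ Z⊆A)
    ...   | inj₂ (inj₂ A⊆Z) = inj₂ (inj₁ (A-greatest Z∈F Z⊂S A⊆Z))

    -- A member inside `S` is laminar with `rest` by `below`, and any other member is disjoint from
    -- `S` or contains it. Maximality then makes the second child a member too.
    rest∈ : rest ∈ₗ F
    rest∈ with proj₂ A⊂S
    ... | i , i∈S , i∉A = maximal (i , ∈rest i∈S i∉A) laminar-rest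
      where
      laminar-rest : ∀ {Z} → Z ∈ₗ F → Laminar Z rest
      laminar-rest Z∈F with laminar Z∈F S∈F
      ... | inj₁ disj       = inj₁ λ x∈Z x∈rest → disj x∈Z (rest⊆ x∈rest)
      ... | inj₂ (inj₂ S⊆Z) = inj₂ (inj₂ (S⊆Z ∘ rest⊆))
      ... | inj₂ (inj₁ Z⊆S) with below Z∈F Z⊆S
      ...   | inj₁ refl          = inj₂ (inj₂ rest⊆)
      ...   | inj₂ (inj₁ Z⊆A)    = inj₁ λ x∈Z x∈rest → rest-disjoint x∈rest (Z⊆A x∈Z)
      ...   | inj₂ (inj₂ Z⊆rest) = inj₂ (inj₁ Z⊆rest)

  TreeBelow : Subset m → Set
  TreeBelow S = Σ[ T ∈ Tree S ] (∀ {Z} → (Z ∈ᵀ T → Z ∈ₗ F) × (Z ∈ₗ F → Z ⊆ S → Z ∈ᵀ T))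

  -- Well-founded recursion on strict inclusion. Either `S` is a singleton, hence a leaf, or the
  -- singleton of one of its elements lies strictly inside it; then a largest proper member and its
  -- complement in `S` are the children.
  treeBelow : ∀ S → S ∈ₗ F → Acc _⊂_ S → TreeBelow S
  treeBelow S S∈F (acc rec) with nonempty S∈F
  ... | i , i∈S with ⁅ i ⁆ Sub.⊂? S
  ...   | no ⊄S = subst TreeBelow ⁅i⁆≡S (leaf i , λ {Z} →
            (λ { (here refl) → ⁅⁆∈ i }) , λ Z∈F Z⊆ → here (Sub.⊆-antisym Z⊆ (⁅i⁆⊆ (nonempty Z∈F) Z⊆)))
    where
    ⁅i⁆⊆S : ⁅ i ⁆ ⊆ S
    ⁅i⁆⊆S x∈ = subst (_∈ S) (sym (Sub.x∈⁅y⁆⇒x≡y i x∈)) i∈S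
    ⁅i⁆≡S : ⁅ i ⁆ ≡ S
    ⁅i⁆≡S = Sub.⊆-antisym ⁅i⁆⊆S (⊆∧⊄⇒⊇ ⁅i⁆⊆S ⊄S)
    ⁅i⁆⊆ : ∀ {Z} → Nonempty Z → Z ⊆ ⁅ i ⁆ → ⁅ i ⁆ ⊆ Z
    ⁅i⁆⊆ {Z} (j , j∈Z) Z⊆ x∈ =
      subst (_∈ Z) (trans (Sub.x∈⁅y⁆⇒x≡y i (Z⊆ j∈Z)) (sym (Sub.x∈⁅y⁆⇒x≡y i x∈))) j∈Z
  ...   | yes ⁅i⁆⊂S with greatest-below (⁅⁆∈ i) ⁅i⁆⊂S
  ...     | A , A∈F , A⊂S , A-greatest = node p l r , λ {Z} → sound , complete
    where
    p = partition S∈F A∈F A⊂S A-greatest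
    L = treeBelow A A∈F (rec A⊂S)
    R = treeBelow (rest S∈F A∈F A⊂S A-greatest) (rest∈ S∈F A∈F A⊂S A-greatest) (rec (rest⊂ S∈F A∈F A⊂S A-greatest))
    l = proj₁ L
    r = proj₁ R
    sound : ∀ {Z} → Z ∈ᵀ node p l r → Z ∈ₗ F
    sound Z∈ with node∈⁻ p l r Z∈
    ... | inj₁ refl       = S∈F
    ... | inj₂ (inj₁ Z∈l) = proj₁ (proj₂ L) Z∈l
    ... | inj₂ (inj₂ Z∈r) = proj₁ (proj₂ R) Z∈r
    complete : ∀ {Z} → Z ∈ₗ F → Z ⊆ S → Z ∈ᵀ node p l r
    complete Z∈F Z⊆S with below S∈F A∈F A⊂S A-greatest Z∈F Z⊆S
    ... | inj₁ refl             = here refl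
    ... | inj₂ (inj₁ Z⊆A)    = left∈ p l r (proj₂ (proj₂ L) Z∈F Z⊆A)
    ... | inj₂ (inj₂ Z⊆rest) = right∈ p l r (proj₂ (proj₂ R) Z∈F Z⊆rest)

-- The full set contains every other set, so it belongs to the family and serves as the root of the
-- tree. The successor in the type makes it nonempty.
maximalLaminar⇒tree : ∀ {m} {F : List (Subset (suc m))} → MaximalLaminar F →
  Σ[ T ∈ Tree ⊤ ] (∀ {Z} → (Z ∈ᵀ T → Z ∈ₗ F) × (Z ∈ₗ F → Z ∈ᵀ T))
maximalLaminar⇒tree {F = F} M with treeBelow ⊤ (maximal (zero , Sub.∈⊤) (λ _ → inj₂ (inj₁ Sub.⊆⊤))) (⊂-wellFounded ⊤)
  where open MaximalLaminar M
... | T , T-nodes = T , λ {Z} → proj₁ T-nodes , λ Z∈F → proj₂ T-nodes Z∈F Sub.⊆⊤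

-- Weights counted along a tree

-- Shores are represented by their side avoiding the vertex zero.
lift : ∀ {m} → Subset m → Subset (suc m)
lift = false ∷_

count-++ : ∀ {n} (K L : List (Subset n)) i j → count (K List.++ L) i j ≡ count K i j ℕ.+ count L i j
count-++ []      L i j = refl
count-++ (X ∷ K) L i j = trans (cong ((if inCut X i j then 1 else 0) ℕ.+_) (count-++ K L i j))
  (sym (ℕₚ.+-assoc (if inCut X i j then 1 else 0) (count K i j) (count L i j)))

count-sym : ∀ {n} (L : List (Subset n)) i j → count L i j ≡ count L j i
count-sym []      i j = refl
count-sym (X ∷ L) i j = cong₂ (λ b k → (if b then 1 else 0) ℕ.+ k) (xor-comm (lookup X i) (lookup X j)) (count-sym L i j)

count-diag : ∀ {n} (L : List (Subset n)) i → count L i i ≡ 0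
count-diag []      i = refl
count-diag (X ∷ L) i rewrite Boolₚ.xor-same (lookup X i) = count-diag L i

treeCount : ∀ {m} {S : Subset m} → Tree S → Fin (suc m) → Fin (suc m) → ℕ
treeCount T = count (List.map lift (toList (nodes T)))

treeCount-node : ∀ {m} {S A B : Subset m} (p : Partition S A B) (l : Tree A) (r : Tree B) i j →
  treeCount (node p l r) i j ≡ (if inCut (lift S) i j then 1 else 0) ℕ.+ (treeCount l i j ℕ.+ treeCount r i j)
treeCount-node {S = S} p l r i j = cong ((if inCut (lift S) i j then 1 else 0) ℕ.+_)
  (trans (cong (λ K → count K i j)
           (trans (cong (List.map lift) (Vecₚ.toList-++ (nodes l) (nodes r))) (Listₚ.map-++ lift (toList (nodes l)) _)))
    (count-++ (List.map lift (toList (nodes l))) _ i j))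

split-outˡ : ∀ {s a b} → Split s a b → s ≡ false → a ≡ false
split-outˡ out refl = refl

split-outʳ : ∀ {s a b} → Split s a b → s ≡ false → b ≡ false
split-outʳ out refl = refl

-- A vertex outside `S` lies in no node of the tree, so the cuts of the tree cannot tell it from the
-- vertex zero.
treeCount-outside : ∀ {m} {S : Subset m} (T : Tree S) {i} → lookup S i ≡ false →
  ∀ j → treeCount T (suc i) j ≡ treeCount T zero j
treeCount-outside (leaf k) i∉S j rewrite i∉S = refl
treeCount-outside (node p l r) {i} i∉S j
  rewrite treeCount-node p l r (suc i) j | treeCount-node p l r zero j | i∉S
        | treeCount-outside l (split-outˡ (at p i) i∉S) j | treeCount-outside r (split-outʳ (at p i) i∉S) j = refl

treeCount-outside₀ : ∀ {m} {S : Subset m} (T : Tree S) {i} → lookup S i ≡ false → treeCount T zero (suc i) ≡ 0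
treeCount-outside₀ T {i} i∉S = begin
  treeCount T zero (suc i) ≡⟨ count-sym (List.map lift (toList (nodes T))) zero (suc i) ⟩
  treeCount T (suc i) zero ≡⟨ treeCount-outside T i∉S zero ⟩
  treeCount T zero zero    ≡⟨ count-diag (List.map lift (toList (nodes T))) zero ⟩
  0 ∎
  where open ≡-Reasoning

treeCount-outsideʳ : ∀ {m} {S : Subset m} (T : Tree S) {i j} → lookup S j ≡ false →
  treeCount T (suc i) (suc j) ≡ treeCount T zero (suc i)
treeCount-outsideʳ T {i} {j} j∉S = begin
  treeCount T (suc i) (suc j) ≡⟨ count-sym (List.map lift (toList (nodes T))) (suc i) (suc j) ⟩
  treeCount T (suc j) (suc i) ≡⟨ treeCount-outside T j∉S (suc i) ⟩
  treeCount T zero (suc i) ∎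
  where open ≡-Reasoning

half^-+ : ∀ a b → half^ (a ℕ.+ b) ≡ half^ a · half^ b
half^-+ zero    b = sym (ℚₚ.*-identityˡ (half^ b))
half^-+ (suc a) b = trans (cong (½ ·_) (half^-+ a b)) (sym (ℚₚ.*-assoc ½ (half^ a) (half^ b)))

-- Opaque so that conversion checking does not evaluate rational numerals.
opaque
  weight : ℕ → ℚ
  weight k = (1ℚ + 1ℚ) · half^ k

  weight-def : ∀ k → weight k ≡ (1ℚ + 1ℚ) · half^ k
  weight-def k = refl

-- The weight is twice a power of one half, so a product of two weights carries one factor two too
-- many.
weight-+ : ∀ a b → weight (a ℕ.+ b) ≡ ½ · (weight a · weight b)
weight-+ a b rewrite weight-def (a ℕ.+ b) | weight-def a | weight-def b | half^-+ a b =
  solve 2 (λ x y → con (1ℚ + 1ℚ) :* (x :* y)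
                := con ½ :* ((con (1ℚ + 1ℚ) :* x) :* (con (1ℚ + 1ℚ) :* y))) refl (half^ a) (half^ b)

weight-suc : ∀ a → weight (suc a) ≡ ½ · weight a
weight-suc a rewrite weight-def (suc a) | weight-def a = solve 1 (λ x → con (1ℚ + 1ℚ) :* (con ½ :* x) := con ½ :* (con (1ℚ + 1ℚ) :* x)) refl (half^ a)

module _ {m : ℕ} (x : Fin m → Bool) where

  massAt : ∀ {S} → Tree S → Fin m → ℚ
  massAt {S} T i = ⟦ lookup S i ∧ x i ⟧ · weight (treeCount T zero (suc i))

  flowAt : ∀ {S} → Tree S → Fin m → Fin m → ℚ
  flowAt {S} T i j = ⟦ lookup S i ∧ x i ⟧ · (⟦ lookup S j ∧ not (x j) ⟧ · weight (treeCount T (suc i) (suc j)))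

  -- The weights of the pairs joining S ∩ x to the root vertex zero, and to S ∖ x, when only the
  -- cuts of the tree are counted.
  mass flow : ∀ {S} → Tree S → ℚ
  mass T = sum (massAt T)
  flow T = sum λ i → sum (flowAt T i)

-- A leaf below one child is separated from the vertex zero by cuts of that child and by the cut of
-- the node itself, which halves the weight; the other child contributes no cut.
massAt-split : ∀ {s a b} → Split s a b → ∀ y {k kₗ kᵣ} → k ≡ (if s then 1 else 0) ℕ.+ (kₗ ℕ.+ kᵣ) →
  (a ≡ false → kₗ ≡ 0) → (b ≡ false → kᵣ ≡ 0) →
  ⟦ s ∧ y ⟧ · weight k ≡ ½ · (⟦ a ∧ y ⟧ · weight kₗ + ⟦ b ∧ y ⟧ · weight kᵣ)
massAt-split out y {k} {kₗ} {kᵣ} _ _ _ =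
  solve 3 (λ u v w → con 0ℚ :* u := con ½ :* (con 0ℚ :* v :+ con 0ℚ :* w)) refl (weight k) (weight kₗ) (weight kᵣ)
massAt-split left y {kₗ = kₗ} refl _ kᵣ≡0
  rewrite kᵣ≡0 refl | ℕₚ.+-identityʳ kₗ | weight-suc kₗ =
  solve 3 (λ y u v → y :* (con ½ :* u) := con ½ :* (y :* u :+ con 0ℚ :* v)) refl ⟦ y ⟧ (weight kₗ) (weight 0)
massAt-split right y {kᵣ = kᵣ} refl kₗ≡0 _
  rewrite kₗ≡0 refl | weight-suc kᵣ =
  solve 3 (λ y u v → y :* (con ½ :* u) := con ½ :* (con 0ℚ :* v :+ y :* u)) refl ⟦ y ⟧ (weight kᵣ) (weight 0)

-- Here `dₗ`, `dᵣ`, `dₗ′`, `dᵣ′` count the cuts between each leaf and the vertex zero in the two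
-- children. Leaves below the same child are separated only by cuts of that child. For leaves below
-- different children the two counts to the vertex zero add up, so the weight becomes half a product
-- by `weight-+`.
flowAt-split : ∀ {s a b s′ a′ b′} → Split s a b → Split s′ a′ b′ → ∀ y y′ {k kₗ kᵣ} dₗ dᵣ dₗ′ dᵣ′ →
  k ≡ (if s xor s′ then 1 else 0) ℕ.+ (kₗ ℕ.+ kᵣ) →
  (a ≡ false → kₗ ≡ dₗ′) → (a′ ≡ false → kₗ ≡ dₗ) → (a ≡ false → dₗ ≡ 0) →
  (b ≡ false → kᵣ ≡ dᵣ′) → (b′ ≡ false → kᵣ ≡ dᵣ) → (b ≡ false → dᵣ ≡ 0) →
  ⟦ s ∧ y ⟧ · (⟦ s′ ∧ y′ ⟧ · weight k) ≡
    (⟦ a ∧ y ⟧ · (⟦ a′ ∧ y′ ⟧ · weight kₗ) + ⟦ b ∧ y ⟧ · (⟦ b′ ∧ y′ ⟧ · weight kᵣ))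
    + ½ · ((⟦ a ∧ y ⟧ · weight dₗ) · (⟦ b′ ∧ y′ ⟧ · weight dᵣ′) + (⟦ b ∧ y ⟧ · weight dᵣ) · (⟦ a′ ∧ y′ ⟧ · weight dₗ′))
flowAt-split {s′ = s′} {a′} {b′} out _ y y′ {k} {kₗ} {kᵣ} dₗ dᵣ dₗ′ dᵣ′ _ _ _ _ _ _ _ =
  solve 7 (λ p q r u v α β → con 0ℚ :* p := (con 0ℚ :* q :+ con 0ℚ :* r) :+ con ½ :* ((con 0ℚ :* u) :* α :+ (con 0ℚ :* v) :* β))
    refl (⟦ s′ ∧ y′ ⟧ · weight k) (⟦ a′ ∧ y′ ⟧ · weight kₗ) (⟦ b′ ∧ y′ ⟧ · weight kᵣ) (weight dₗ) (weight dᵣ)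
    (⟦ b′ ∧ y′ ⟧ · weight dᵣ′) (⟦ a′ ∧ y′ ⟧ · weight dₗ′)
flowAt-split {s} {a} {b} left out y y′ {k} {kₗ} {kᵣ} dₗ dᵣ dₗ′ dᵣ′ _ _ _ _ _ _ _ =
  solve 8 (λ y p q r u v α β → y :* (con 0ℚ :* p) := (y :* (con 0ℚ :* q) :+ con 0ℚ :* (con 0ℚ :* r)) :+ con ½ :* ((y :* u) :* (con 0ℚ :* α) :+ (con 0ℚ :* v) :* (con 0ℚ :* β)))
    refl ⟦ y ⟧ (weight k) (weight kₗ) (weight kᵣ) (weight dₗ) (weight dᵣ) (weight dᵣ′) (weight dₗ′)
flowAt-split right out y y′ {k} {kₗ} {kᵣ} dₗ dᵣ dₗ′ dᵣ′ _ _ _ _ _ _ _ =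
  solve 8 (λ y p q r u v α β → y :* (con 0ℚ :* p) := (con 0ℚ :* (con 0ℚ :* q) :+ y :* (con 0ℚ :* r)) :+ con ½ :* ((con 0ℚ :* u) :* (con 0ℚ :* α) :+ (y :* v) :* (con 0ℚ :* β)))
    refl ⟦ y ⟧ (weight k) (weight kₗ) (weight kᵣ) (weight dₗ) (weight dᵣ) (weight dᵣ′) (weight dₗ′)
flowAt-split left left y y′ {kₗ = kₗ} dₗ dᵣ dₗ′ dᵣ′ refl _ _ _ _ kᵣ≡dᵣ dᵣ≡0
  rewrite kᵣ≡dᵣ refl | dᵣ≡0 refl | ℕₚ.+-identityʳ kₗ =
  solve 7 (λ y y′ p q u α β → y :* (y′ :* p) := (y :* (y′ :* p) :+ con 0ℚ :* (con 0ℚ :* q)) :+ con ½ :* ((y :* u) :* (con 0ℚ :* α) :+ (con 0ℚ :* q) :* (y′ :* β)))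
    refl ⟦ y ⟧ ⟦ y′ ⟧ (weight kₗ) (weight 0) (weight dₗ) (weight dᵣ′) (weight dₗ′)
flowAt-split right right y y′ {kᵣ = kᵣ} dₗ dᵣ dₗ′ dᵣ′ refl _ kₗ≡dₗ dₗ≡0 _ _ _
  rewrite kₗ≡dₗ refl | dₗ≡0 refl =
  solve 7 (λ y y′ p q u α β → y :* (y′ :* p) := (con 0ℚ :* (con 0ℚ :* q) :+ y :* (y′ :* p)) :+ con ½ :* ((con 0ℚ :* q) :* (y′ :* α) :+ (y :* u) :* (con 0ℚ :* β)))
    refl ⟦ y ⟧ ⟦ y′ ⟧ (weight kᵣ) (weight 0) (weight dᵣ) (weight dᵣ′) (weight dₗ′)
flowAt-split left right y y′ dₗ dᵣ dₗ′ dᵣ′ refl _ kₗ≡dₗ _ kᵣ≡dᵣ′ _ _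
  rewrite kₗ≡dₗ refl | kᵣ≡dᵣ′ refl | weight-+ dₗ dᵣ′ =
  solve 6 (λ y y′ u v α β → y :* (y′ :* (con ½ :* (u :* α))) := (y :* (con 0ℚ :* u) :+ con 0ℚ :* (y′ :* α)) :+ con ½ :* ((y :* u) :* (y′ :* α) :+ (con 0ℚ :* v) :* (con 0ℚ :* β)))
    refl ⟦ y ⟧ ⟦ y′ ⟧ (weight dₗ) (weight dᵣ) (weight dᵣ′) (weight dₗ′)
flowAt-split right left y y′ dₗ dᵣ dₗ′ dᵣ′ refl kₗ≡dₗ′ _ _ _ kᵣ≡dᵣ _
  rewrite kₗ≡dₗ′ refl | kᵣ≡dᵣ refl | weight-+ dₗ′ dᵣ =
  solve 6 (λ y y′ u v α β → y :* (y′ :* (con ½ :* (β :* v))) := (con 0ℚ :* (y′ :* β) :+ y :* (con 0ℚ :* v)) :+ con ½ :* ((con 0ℚ :* u) :* (con 0ℚ :* α) :+ (y :* v) :* (y′ :* β)))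
    refl ⟦ y ⟧ ⟦ y′ ⟧ (weight dₗ) (weight dᵣ) (weight dᵣ′) (weight dₗ′)

module _ {m : ℕ} {S A B : Subset m} (p : Partition S A B) (l : Tree A) (r : Tree B) where

  mass-node : ∀ x → mass x (node p l r) ≡ ½ · (mass x l + mass x r)
  mass-node x = begin
    mass x (node p l r)                          ≡⟨ sum-cong-≗ (λ i → massAt-split (at p i) (x i)
        (treeCount-node p l r zero (suc i)) (treeCount-outside₀ l) (treeCount-outside₀ r)) ⟩
    sum (λ i → ½ · (massAt x l i + massAt x r i)) ≡⟨ *-distribˡ-sum ½ (λ i → massAt x l i + massAt x r i) ⟨
    ½ · sum (λ i → massAt x l i + massAt x r i)   ≡⟨ cong (½ ·_) (∑-distrib-+ (massAt x l) (massAt x r)) ⟩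
    ½ · (mass x l + mass x r) ∎
    where open ≡-Reasoning

  -- The terms across the children are products of a factor in `i` and a factor in `j`, so their
  -- double sum factors into masses: leaves in `x` below one child against leaves outside `x` below
  -- the other.
  flow-node : ∀ x → flow x (node p l r) ≡
    (flow x l + flow x r) + ½ · (mass x l · mass (not ∘ x) r + mass x r · mass (not ∘ x) l)
  flow-node x = begin
    flow x (node p l r) ≡⟨ sum-cong-≗ row ⟩
    sum (λ i → (fl i + fr i) + ½ · (ml i · Mr + mr i · Ml))
      ≡⟨ ∑-distrib-+ (λ i → fl i + fr i) (λ i → ½ · (ml i · Mr + mr i · Ml)) ⟩
    sum (λ i → fl i + fr i) + sum (λ i → ½ · (ml i · Mr + mr i · Ml))
      ≡⟨ cong₂ _+_ (∑-distrib-+ fl fr) (begin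
           sum (λ i → ½ · (ml i · Mr + mr i · Ml))   ≡⟨ *-distribˡ-sum ½ (λ i → ml i · Mr + mr i · Ml) ⟨
           ½ · sum (λ i → ml i · Mr + mr i · Ml)     ≡⟨ cong (½ ·_) (∑-distrib-+ (λ i → ml i · Mr) (λ i → mr i · Ml)) ⟩
           ½ · (sum (λ i → ml i · Mr) + sum (λ i → mr i · Ml))
             ≡⟨ cong (½ ·_) (cong₂ _+_ (*-distribʳ-sum Mr ml) (*-distribʳ-sum Ml mr)) ⟨
           ½ · (mass x l · Mr + mass x r · Ml) ∎) ⟩
    (flow x l + flow x r) + ½ · (mass x l · Mr + mass x r · Ml) ∎
    where
    open ≡-Reasoning
    ml = massAt x l
    mr = massAt x r
    ml′ = massAt (not ∘ x) l
    mr′ = massAt (not ∘ x) r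
    Ml = sum ml′
    Mr = sum mr′
    fl = λ i → sum (flowAt x l i)
    fr = λ i → sum (flowAt x r i)
    entry : ∀ i j → flowAt x (node p l r) i j ≡
      (flowAt x l i j + flowAt x r i j) + ½ · (ml i · mr′ j + mr i · ml′ j)
    entry i j = flowAt-split (at p i) (at p j) (x i) (not (x j))
      (treeCount l zero (suc i)) (treeCount r zero (suc i)) (treeCount l zero (suc j)) (treeCount r zero (suc j))
      (treeCount-node p l r (suc i) (suc j))
      (λ i∉A → treeCount-outside l i∉A (suc j)) (treeCount-outsideʳ l) (treeCount-outside₀ l)
      (λ i∉B → treeCount-outside r i∉B (suc j)) (treeCount-outsideʳ r) (treeCount-outside₀ r)
    row : ∀ i → sum (flowAt x (node p l r) i) ≡ (fl i + fr i) + ½ · (ml i · Mr + mr i · Ml)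
    row i = begin
      sum (flowAt x (node p l r) i) ≡⟨ sum-cong-≗ (entry i) ⟩
      sum (λ j → (flowAt x l i j + flowAt x r i j) + ½ · (ml i · mr′ j + mr i · ml′ j))
        ≡⟨ ∑-distrib-+ (λ j → flowAt x l i j + flowAt x r i j) (λ j → ½ · (ml i · mr′ j + mr i · ml′ j)) ⟩
      sum (λ j → flowAt x l i j + flowAt x r i j) + sum (λ j → ½ · (ml i · mr′ j + mr i · ml′ j))
        ≡⟨ cong₂ _+_ (∑-distrib-+ (flowAt x l i) (flowAt x r i)) (begin
             sum (λ j → ½ · (ml i · mr′ j + mr i · ml′ j))   ≡⟨ *-distribˡ-sum ½ (λ j → ml i · mr′ j + mr i · ml′ j) ⟨
             ½ · sum (λ j → ml i · mr′ j + mr i · ml′ j)     ≡⟨ cong (½ ·_) (∑-distrib-+ (λ j → ml i · mr′ j) (λ j → mr i · ml′ j)) ⟩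
             ½ · (sum (λ j → ml i · mr′ j) + sum (λ j → mr i · ml′ j))
               ≡⟨ cong (½ ·_) (cong₂ _+_ (*-distribˡ-sum (ml i) mr′) (*-distribˡ-sum (mr i) ml′)) ⟨
             ½ · (ml i · Mr + mr i · Ml) ∎) ⟩
      (fl i + fr i) + ½ · (ml i · Mr + mr i · Ml) ∎

-- The minimum cuts of a tree

0≤+ : ∀ {p q} → 0ℚ ℚ.≤ p → 0ℚ ℚ.≤ q → 0ℚ ℚ.≤ p + q
0≤+ = ℚₚ.+-mono-≤

0≤* : ∀ {p q} → 0ℚ ℚ.≤ p → 0ℚ ℚ.≤ q → 0ℚ ℚ.≤ p · q
0≤* {p} {q} 0≤p 0≤q = ℚₚ.nonNegative⁻¹ (p · q) {{ℚₚ.nonNeg*nonNeg⇒nonNeg p {{ℚ.nonNegative 0≤p}} q {{ℚ.nonNegative 0≤q}}}}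

0<* : ∀ {p q} → 0ℚ < p → 0ℚ < q → 0ℚ < p · q
0<* {p} {q} 0<p 0<q = ℚₚ.positive⁻¹ (p · q) {{ℚₚ.pos*pos⇒pos p {{ℚ.positive 0<p}} q {{ℚ.positive 0<q}}}}

0<½ : 0ℚ < ½
0<½ = ℚₚ.positive⁻¹ ½

0≤½ : 0ℚ ℚ.≤ ½
0≤½ = ℚₚ.nonNegative⁻¹ ½

-- Lower bounds on the flow f of a set of mass a that splits the leaves, as nonnegative slacks.
record Splits (a f : ℚ) : Set where
  field
    pos    : 0ℚ < a
    below₁ : 0ℚ ℚ.≤ 1ℚ - a
    inner  : 0ℚ ℚ.≤ f - a
    outer  : 0ℚ ℚ.≤ f + a - 1ℚ

  flow-pos : 0ℚ < f
  flow-pos = subst (0ℚ <_) (lemma a f) (ℚₚ.+-mono-<-≤ pos inner)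
    where
    lemma : ∀ a f → a + (f - a) ≡ f
    lemma = solve 2 (λ a f → a :+ (f :- a) := f) refl

  mass-nonneg : 0ℚ ℚ.≤ a
  mass-nonneg = ℚₚ.<⇒≤ pos

open Splits

joinMass : ℚ → ℚ → ℚ
joinMass a b = ½ · (a + b)

-- The recursion of `flow-node` with each complementary mass replaced by one minus the mass.
joinFlow : ℚ → ℚ → ℚ → ℚ → ℚ
joinFlow a f b g = (f + g) + ½ · (a · (1ℚ - b) + b · (1ℚ - a))

joinMass-comm : ∀ a b → joinMass a b ≡ joinMass b a
joinMass-comm = solve 2 (λ a b → con ½ :* (a :+ b) := con ½ :* (b :+ a)) refl

joinFlow-comm : ∀ a f b g → joinFlow a f b g ≡ joinFlow b g a f
joinFlow-comm = solve 4 (λ a f b g →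
  (f :+ g) :+ con ½ :* (a :* (con 1ℚ :- b) :+ b :* (con 1ℚ :- a)) :=
  (g :+ f) :+ con ½ :* (b :* (con 1ℚ :- a) :+ a :* (con 1ℚ :- b))) refl

-- Joining with an avoided child turns half of the mass `b` into flow. The sum of flow and mass, and
-- with it the outer slack, is unchanged, while the inner slack becomes `g`.
none-splits : ∀ {b g} → Splits b g → Splits (joinMass 0ℚ b) (joinFlow 0ℚ 0ℚ b g)
none-splits {b} {g} s = record
  { pos    = subst (0ℚ <_) (eq₁ b) (0<* 0<½ (pos s))
  ; below₁ = subst (0ℚ ℚ.≤_) (eq₂ b) (0≤+ 0≤½ (0≤* 0≤½ (below₁ s)))
  ; inner  = subst (0ℚ ℚ.≤_) (eq₃ b g) (ℚₚ.<⇒≤ (flow-pos s))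
  ; outer  = subst (0ℚ ℚ.≤_) (eq₄ b g) (outer s)
  }
  where
  eq₁ : ∀ b → ½ · b ≡ joinMass 0ℚ b
  eq₁ = solve 1 (λ b → con ½ :* b := con ½ :* (con 0ℚ :+ b)) refl
  eq₂ : ∀ b → ½ + ½ · (1ℚ - b) ≡ 1ℚ - joinMass 0ℚ b
  eq₂ = solve 1 (λ b → con ½ :+ con ½ :* (con 1ℚ :- b) := con 1ℚ :- con ½ :* (con 0ℚ :+ b)) refl
  eq₃ : ∀ b g → g ≡ joinFlow 0ℚ 0ℚ b g - joinMass 0ℚ b
  eq₃ = solve 2 (λ b g → g := (con 0ℚ :+ g) :+ con ½ :* (con 0ℚ :* (con 1ℚ :- b) :+ b :* (con 1ℚ :- con 0ℚ)) :- con ½ :* (con 0ℚ :+ b)) refl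
  eq₄ : ∀ b g → g + b - 1ℚ ≡ joinFlow 0ℚ 0ℚ b g + joinMass 0ℚ b - 1ℚ
  eq₄ = solve 2 (λ b g → g :+ b :- con 1ℚ := (con 0ℚ :+ g) :+ con ½ :* (con 0ℚ :* (con 1ℚ :- b) :+ b :* (con 1ℚ :- con 0ℚ)) :+ con ½ :* (con 0ℚ :+ b) :- con 1ℚ) refl

none-sum : ∀ b g → joinFlow 0ℚ 0ℚ b g + joinMass 0ℚ b ≡ g + b
none-sum = solve 2 (λ b g → (con 0ℚ :+ g) :+ con ½ :* (con 0ℚ :* (con 1ℚ :- b) :+ b :* (con 1ℚ :- con 0ℚ)) :+ con ½ :* (con 0ℚ :+ b) := g :+ b) refl

-- Mass and flow are both one half, so the inner and outer slacks are exactly zero.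
none-all : Splits (joinMass 0ℚ 1ℚ) (joinFlow 0ℚ 0ℚ 1ℚ 0ℚ)
none-all = record { pos = 0<½ ; below₁ = 0≤½ ; inner = ℚₚ.≤-refl ; outer = ℚₚ.≤-refl }

-- The inner slack of the split child is inherited and the outer slack becomes its flow `g`, which
-- is positive. This strictness is what excludes minimum cuts other than nodes.
all-splits : ∀ {b g} → Splits b g →
  Splits (joinMass 1ℚ b) (joinFlow 1ℚ 0ℚ b g) × 0ℚ < joinFlow 1ℚ 0ℚ b g + joinMass 1ℚ b - 1ℚ
all-splits {b} {g} s = record
  { pos    = subst (0ℚ <_) (eq₁ b) (ℚₚ.+-mono-< 0<½ (0<* 0<½ (pos s)))
  ; below₁ = subst (0ℚ ℚ.≤_) (eq₂ b) (0≤* 0≤½ (below₁ s))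
  ; inner  = subst (0ℚ ℚ.≤_) (eq₃ b g) (inner s)
  ; outer  = ℚₚ.<⇒≤ strict
  } , strict
  where
  eq₁ : ∀ b → ½ + ½ · b ≡ joinMass 1ℚ b
  eq₁ = solve 1 (λ b → con ½ :+ con ½ :* b := con ½ :* (con 1ℚ :+ b)) refl
  eq₂ : ∀ b → ½ · (1ℚ - b) ≡ 1ℚ - joinMass 1ℚ b
  eq₂ = solve 1 (λ b → con ½ :* (con 1ℚ :- b) := con 1ℚ :- con ½ :* (con 1ℚ :+ b)) refl
  eq₃ : ∀ b g → g - b ≡ joinFlow 1ℚ 0ℚ b g - joinMass 1ℚ b
  eq₃ = solve 2 (λ b g → g :- b := (con 0ℚ :+ g) :+ con ½ :* (con 1ℚ :* (con 1ℚ :- b) :+ b :* (con 1ℚ :- con 1ℚ)) :- con ½ :* (con 1ℚ :+ b)) refl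
  eq₄ : ∀ b g → g ≡ joinFlow 1ℚ 0ℚ b g + joinMass 1ℚ b - 1ℚ
  eq₄ = solve 2 (λ b g → g := (con 0ℚ :+ g) :+ con ½ :* (con 1ℚ :* (con 1ℚ :- b) :+ b :* (con 1ℚ :- con 1ℚ)) :+ con ½ :* (con 1ℚ :+ b) :- con 1ℚ) refl
  strict = subst (0ℚ <_) (eq₄ b g) (flow-pos s)

-- Each new slack is the corresponding slack of the first child, plus a product of a mass and a
-- complementary mass, plus the positive flow `g`.
splits-splits : ∀ {a f b g} → Splits a f → Splits b g →
  Splits (joinMass a b) (joinFlow a f b g) × 0ℚ < joinFlow a f b g + joinMass a b - 1ℚ
splits-splits {a} {f} {b} {g} s t = record
  { pos    = subst (0ℚ <_) (eq₁ a b) (0<* 0<½ (ℚₚ.+-mono-< (pos s) (pos t)))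
  ; below₁ = subst (0ℚ ℚ.≤_) (eq₂ a b) (0≤* 0≤½ (0≤+ (below₁ s) (below₁ t)))
  ; inner  = subst (0ℚ ℚ.≤_) (eq₃ a f b g) (0≤+ (0≤+ (inner s) (0≤* (mass-nonneg s) (below₁ t))) (ℚₚ.<⇒≤ (flow-pos t)))
  ; outer  = ℚₚ.<⇒≤ strict
  } , strict
  where
  eq₁ : ∀ a b → ½ · (a + b) ≡ joinMass a b
  eq₁ a b = refl
  eq₂ : ∀ a b → ½ · ((1ℚ - a) + (1ℚ - b)) ≡ 1ℚ - joinMass a b
  eq₂ = solve 2 (λ a b → con ½ :* ((con 1ℚ :- a) :+ (con 1ℚ :- b)) := con 1ℚ :- con ½ :* (a :+ b)) refl
  eq₃ : ∀ a f b g → ((f - a) + a · (1ℚ - b)) + g ≡ joinFlow a f b g - joinMass a b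
  eq₃ = solve 4 (λ a f b g → ((f :- a) :+ a :* (con 1ℚ :- b)) :+ g :=
    (f :+ g) :+ con ½ :* (a :* (con 1ℚ :- b) :+ b :* (con 1ℚ :- a)) :- con ½ :* (a :+ b)) refl
  eq₄ : ∀ a f b g → g + ((f + a - 1ℚ) + b · (1ℚ - a)) ≡ joinFlow a f b g + joinMass a b - 1ℚ
  eq₄ = solve 4 (λ a f b g → g :+ ((f :+ a :- con 1ℚ) :+ b :* (con 1ℚ :- a)) :=
    (f :+ g) :+ con ½ :* (a :* (con 1ℚ :- b) :+ b :* (con 1ℚ :- a)) :+ con ½ :* (a :+ b) :- con 1ℚ) refl
  strict = subst (0ℚ <_) (eq₄ a f b g)
    (ℚₚ.+-mono-<-≤ (flow-pos t) (0≤+ (outer s) (0≤* (mass-nonneg t) (below₁ s))))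

ConstOn : ∀ {m} → Bool → Subset m → (Fin m → Bool) → Set
ConstOn b S x = ∀ i → lookup S i ≡ true → x i ≡ b

⟦false⟧ : ∀ {b} → b ≡ false → ∀ q → ⟦ b ⟧ · q ≡ 0ℚ
⟦false⟧ refl q = ℚₚ.*-zeroˡ q

module _ {m : ℕ} {S : Subset m} (T : Tree S) where

  constOn-∧ : ∀ {x} → ConstOn false S x → ∀ i → lookup S i ∧ x i ≡ false
  constOn-∧ none i with lookup S i in eq
  ... | true  = none i eq
  ... | false = refl

  mass-none : ∀ {x} → ConstOn false S x → mass x T ≡ 0ℚ
  mass-none none = sum-zero _ λ i → ⟦false⟧ (constOn-∧ none i) (weight (treeCount T zero (suc i)))

  flow-none : ∀ {x} → ConstOn false S x → flow x T ≡ 0ℚ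
  flow-none {x} none = sum-zero _ λ i → sum-zero _ λ j →
    ⟦false⟧ (constOn-∧ none i) (⟦ lookup S j ∧ not (x j) ⟧ · weight (treeCount T (suc i) (suc j)))

  flow-all : ∀ {x} → ConstOn true S x → flow x T ≡ 0ℚ
  flow-all {x} all = sum-zero _ λ i → sum-zero _ λ j →
    trans (cong (⟦ lookup S i ∧ x i ⟧ ·_)
            (⟦false⟧ (constOn-∧ {not ∘ x} (λ k → cong not ∘ all k) j) (weight (treeCount T (suc i) (suc j)))))
          (ℚₚ.*-zeroʳ ⟦ lookup S i ∧ x i ⟧)

⟦∧⟧ : ∀ a b q → ⟦ a ∧ b ⟧ · q ≡ ⟦ a ⟧ · (⟦ b ⟧ · q)
⟦∧⟧ true  b q = sym (ℚₚ.*-identityˡ _)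
⟦∧⟧ false b q = trans (ℚₚ.*-zeroˡ q) (sym (ℚₚ.*-zeroˡ (⟦ b ⟧ · q)))

weight-1 : weight 1 ≡ 1ℚ
weight-1 = weight-def 1

mass-leaf : ∀ {m} x (i : Fin m) → mass x (leaf i) ≡ ⟦ x i ⟧
mass-leaf x i = begin
  mass x (leaf i) ≡⟨ sum-cong-≗ (λ j → ⟦∧⟧ (lookup ⁅ i ⁆ j) (x j) (weight (treeCount (leaf i) zero (suc j)))) ⟩
  sum (λ j → ⟦ lookup ⁅ i ⁆ j ⟧ · (⟦ x j ⟧ · weight (treeCount (leaf i) zero (suc j)))) ≡⟨ sum-⁅⁆ i (λ j → ⟦ x j ⟧ · weight (treeCount (leaf i) zero (suc j))) ⟩
  ⟦ x i ⟧ · weight (treeCount (leaf i) zero (suc i))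
    ≡⟨ cong (λ b → ⟦ x i ⟧ · weight ((if b then 1 else 0) ℕ.+ 0)) (Vecₚ.[]=⇒lookup (Sub.x∈⁅x⁆ i)) ⟩
  ⟦ x i ⟧ · weight 1 ≡⟨ cong (⟦ x i ⟧ ·_) weight-1 ⟩
  ⟦ x i ⟧ · 1ℚ       ≡⟨ ℚₚ.*-identityʳ ⟦ x i ⟧ ⟩
  ⟦ x i ⟧ ∎
  where open ≡-Reasoning

-- A leaf is cut off once and so has mass one, thanks to the shift by one in the exponent; each node
-- averages its children, which preserves the total.
mass-total : ∀ {m} {S : Subset m} (T : Tree S) x → mass x T + mass (not ∘ x) T ≡ 1ℚ
mass-total (leaf i) x rewrite mass-leaf x i | mass-leaf (not ∘ x) i with x i
... | true  = refl
... | false = refl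
mass-total (node p l r) x = begin
  mass x (node p l r) + mass (not ∘ x) (node p l r) ≡⟨ cong₂ _+_ (mass-node p l r x) (mass-node p l r (not ∘ x)) ⟩
  ½ · (a + b) + ½ · (a′ + b′)    ≡⟨ regroup a b a′ b′ ⟩
  ½ · ((a + a′) + (b + b′))      ≡⟨ cong₂ (λ u v → ½ · (u + v)) (mass-total l x) (mass-total r x) ⟩
  1ℚ ∎
  where
  open ≡-Reasoning
  a = mass x l
  b = mass x r
  a′ = mass (not ∘ x) l
  b′ = mass (not ∘ x) r
  regroup : ∀ a b a′ b′ → ½ · (a + b) + ½ · (a′ + b′) ≡ ½ · ((a + a′) + (b + b′))
  regroup = solve 4 (λ a b a′ b′ → con ½ :* (a :+ b) :+ con ½ :* (a′ :+ b′) := con ½ :* ((a :+ a′) :+ (b :+ b′))) refl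

mass-not : ∀ {m} {S : Subset m} (T : Tree S) x → mass (not ∘ x) T ≡ 1ℚ - mass x T
mass-not T x = trans (move (mass x T) (mass (not ∘ x) T)) (cong (_- mass x T) (mass-total T x))
  where
  move : ∀ a b → b ≡ (a + b) - a
  move = solve 2 (λ a b → b := (a :+ b) :- a) refl

mass-all : ∀ {m} {S : Subset m} (T : Tree S) {x} → ConstOn true S x → mass x T ≡ 1ℚ
mass-all T {x} all = begin
  mass x T                     ≡⟨ ℚₚ.+-identityʳ (mass x T) ⟨
  mass x T + 0ℚ                ≡⟨ cong (mass x T +_) (mass-none T (λ i → cong not ∘ all i)) ⟨
  mass x T + mass (not ∘ x) T  ≡⟨ mass-total T x ⟩
  1ℚ ∎
  where open ≡-Reasoning

flow-join : ∀ {m} {S A B : Subset m} (p : Partition S A B) (l : Tree A) (r : Tree B) x →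
  flow x (node p l r) ≡ joinFlow (mass x l) (flow x l) (mass x r) (flow x r)
flow-join p l r x = trans (flow-node p l r x)
  (cong₂ (λ u v → (flow x l + flow x r) + ½ · (mass x l · u + mass x r · v)) (mass-not r x) (mass-not l x))

IsShore : ∀ {m} {S : Subset m} → Tree S → (Fin m → Bool) → Set
IsShore {S = S} T x = ∃[ Z ] Z ∈ᵀ T × (∀ i → lookup S i ≡ true → x i ≡ lookup Z i)

Tight : ∀ {m} {S : Subset m} → Tree S → (Fin m → Bool) → ℚ → ℚ → Set
Tight T x a f = f + a - 1ℚ ≡ 0ℚ → IsShore T x

-- The constant cases must be kept apart from the invariant: an empty set has flow plus mass zero,
-- violating `outer`, and a full set has flow zero and mass one, violating `inner`.
data Status {m : ℕ} {S : Subset m} (T : Tree S) (x : Fin m → Bool) : Set where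
  none : ConstOn false S x → Status T x
  all  : ConstOn true S x → Status T x
  some : Splits (mass x T) (flow x T) × Tight T x (mass x T) (flow x T) → Status T x

⊆⇒lookup-false : ∀ {m} {A B : Subset m} → A ⊆ B → ∀ {i} → lookup B i ≡ false → lookup A i ≡ false
⊆⇒lookup-false {A = A} {B} A⊆B {i} i∉B with lookup A i in eq
... | false = refl
... | true  = trans (sym (Vecₚ.[]=⇒lookup (A⊆B (Vecₚ.lookup⇒[]= i A eq)))) i∉B

all⇒shore : ∀ {m} {S : Subset m} (T : Tree S) {x} → ConstOn true S x → IsShore T x
all⇒shore {S = S} T allS = S , root∈ T , λ i i∈S → trans (allS i i∈S) (sym i∈S)

const-join : ∀ {m} {S A B : Subset m} → Partition S A B → ∀ {b x} → ConstOn b A x → ConstOn b B x → ConstOn b S x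
const-join {S = S} {A} {B} p constA constB i i∈S with lookup S i | lookup A i in eqA | lookup B i in eqB | at p i
... | _ | _ | _ | left  = constA i eqA
... | _ | _ | _ | right = constB i eqB
const-join p constA constB i () | _ | _ | _ | out

module _ {m : ℕ} {S A B : Subset m} (p : Partition S A B) (l : Tree A) (r : Tree B) (x : Fin m → Bool) where

  extendˡ : ConstOn false B x → IsShore l x → IsShore (node p l r) x
  extendˡ noneB (Z , Z∈l , agree) = Z , left∈ p l r Z∈l , agree′
    where
    agree′ : ∀ i → lookup S i ≡ true → x i ≡ lookup Z i
    agree′ i i∈S with lookup S i | lookup A i in eqA | lookup B i in eqB | at p i
    ... | _ | _ | _ | left  = agree i eqA
    ... | _ | _ | _ | right = trans (noneB i eqB) (sym (⊆⇒lookup-false (∈ᵀ⇒⊆ l Z∈l) eqA))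
    agree′ i () | _ | _ | _ | out

  extendʳ : ConstOn false A x → IsShore r x → IsShore (node p l r) x
  extendʳ noneA (Z , Z∈r , agree) = Z , right∈ p l r Z∈r , agree′
    where
    agree′ : ∀ i → lookup S i ≡ true → x i ≡ lookup Z i
    agree′ i i∈S with lookup S i | lookup A i in eqA | lookup B i in eqB | at p i
    ... | _ | _ | _ | right = agree i eqB
    ... | _ | _ | _ | left  = trans (noneA i eqA) (sym (⊆⇒lookup-false (∈ᵀ⇒⊆ r Z∈r) eqB))
    agree′ i () | _ | _ | _ | out

  module _ (P : ℚ → ℚ → Set) {a f b g : ℚ}
           (ma : mass x l ≡ a) (fl : flow x l ≡ f) (mb : mass x r ≡ b) (fr : flow x r ≡ g) where

    -- The values of the children are parameters, so that the constants `0ℚ` and `1ℚ` of a constant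
    -- child can be put in before a numerical lemma is applied.
    joined : P (joinMass a b) (joinFlow a f b g) → P (mass x (node p l r)) (flow x (node p l r))
    joined rewrite sym ma | sym fl | sym mb | sym fr =
      subst₂ P (sym (mass-node p l r x)) (sym (flow-join p l r x))

    -- Allows each numerical lemma to be stated for one order of the children only.
    joined-swap : P (joinMass b a) (joinFlow b g a f) → P (mass x (node p l r)) (flow x (node p l r))
    joined-swap = joined ∘ subst₂ P (joinMass-comm b a) (joinFlow-comm b g a f)

strict⇒¬tight : ∀ {q} {C : Set} → 0ℚ < q → q ≡ 0ℚ → C
strict⇒¬tight 0<q q≡0 = ⊥-elim (ℚₚ.<-irrefl (sym q≡0) 0<q)

-- If `x` avoids one child, a node witnessing tightness in the other child still serves. If one
-- child splits and the other is not avoided, the outer slack is positive and `Tight` holds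
-- vacuously.
status : ∀ {m} {S : Subset m} (T : Tree S) x → Status T x
status (leaf i) x with x i in eq
... | true  = all λ j j∈ → trans (cong x (Sub.x∈⁅y⁆⇒x≡y i (Vecₚ.lookup⇒[]= j ⁅ i ⁆ j∈))) eq
... | false = none λ j j∈ → trans (cong x (Sub.x∈⁅y⁆⇒x≡y i (Vecₚ.lookup⇒[]= j ⁅ i ⁆ j∈))) eq
status T@(node p l r) x with status l x | status r x
... | none nl | none nr = none (const-join p nl nr)
... | all al  | all ar  = all (const-join p al ar)
... | none nl | all ar  = some (joined p l r x (λ a f → Splits a f × Tight T x a f)
  (mass-none l nl) (flow-none l nl) (mass-all r ar) (flow-all r ar)
  (none-all , λ _ → extendʳ p l r x nl (all⇒shore r ar)))
... | all al  | none nr = some (joined-swap p l r x (λ a f → Splits a f × Tight T x a f)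
  (mass-all l al) (flow-all l al) (mass-none r nr) (flow-none r nr)
  (none-all , λ _ → extendˡ p l r x nr (all⇒shore l al)))
... | none nl | some (s , tight) = some (joined p l r x (λ a f → Splits a f × Tight T x a f)
  (mass-none l nl) (flow-none l nl) refl refl
  (none-splits s , λ e → extendʳ p l r x nl (tight (trans (cong (_- 1ℚ) (sym (none-sum (mass x r) (flow x r)))) e))))
... | some (s , tight) | none nr = some (joined-swap p l r x (λ a f → Splits a f × Tight T x a f)
  refl refl (mass-none r nr) (flow-none r nr)
  (none-splits s , λ e → extendˡ p l r x nr (tight (trans (cong (_- 1ℚ) (sym (none-sum (mass x l) (flow x l)))) e))))
... | all al | some (s , _) = some (joined p l r x (λ a f → Splits a f × Tight T x a f)
  (mass-all l al) (flow-all l al) refl refl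
  (proj₁ (all-splits s) , strict⇒¬tight (proj₂ (all-splits s))))
... | some (s , _) | all ar = some (joined-swap p l r x (λ a f → Splits a f × Tight T x a f)
  refl refl (mass-all r ar) (flow-all r ar)
  (proj₁ (all-splits s) , strict⇒¬tight (proj₂ (all-splits s))))
... | some (s , _) | some (t , _) = some (joined p l r x (λ a f → Splits a f × Tight T x a f)
  refl refl refl refl
  (proj₁ (splits-splits s t) , strict⇒¬tight (proj₂ (splits-splits s t))))

0≤q-p⇒p≤q : ∀ {p q} → 0ℚ ℚ.≤ q - p → p ℚ.≤ q
0≤q-p⇒p≤q {p} {q} 0≤q-p = subst₂ ℚ._≤_ (ℚₚ.+-identityʳ p) (lemma p q) (ℚₚ.+-monoʳ-≤ p 0≤q-p)
  where
  lemma : ∀ p q → p + (q - p) ≡ q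
  lemma = solve 2 (λ p q → p :+ (q :- p) := q) refl

module _ {m : ℕ} {S : Subset m} (T : Tree S) {x : Fin m → Bool} where

  all⇒sum≡1 : ConstOn true S x → flow x T + mass x T ≡ 1ℚ
  all⇒sum≡1 allS = cong₂ _+_ (flow-all T allS) (mass-all T allS)

  sum≥1 : ¬ ConstOn false S x → 1ℚ ℚ.≤ flow x T + mass x T
  sum≥1 ¬none with status T x
  ... | none n       = contradiction n ¬none
  ... | all a        = ℚₚ.≤-reflexive (sym (all⇒sum≡1 a))
  ... | some (s , _) = 0≤q-p⇒p≤q (outer s)

  sum≡1⇒shore : ¬ ConstOn false S x → flow x T + mass x T ≡ 1ℚ → IsShore T x
  sum≡1⇒shore ¬none sum≡1 with status T x
  ... | none n           = contradiction n ¬none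
  ... | all a            = all⇒shore T a
  ... | some (_ , tight) = tight (cong (_- 1ℚ) sum≡1)

-- On the way from the root down to `Z` the other child is avoided at each step, which leaves the
-- sum unchanged by `none-sum`; at `Z` itself the set is full.
shore⇒sum≡1 : ∀ {m} {S Z : Subset m} (T : Tree S) → Z ∈ᵀ T → flow (lookup Z) T + mass (lookup Z) T ≡ 1ℚ
shore⇒sum≡1 T@(leaf i) (here refl) = all⇒sum≡1 T λ _ i∈S → i∈S
shore⇒sum≡1 {Z = Z} T@(node {S} {A} {B} p l r) Z∈ with node∈⁻ p l r Z∈
... | inj₁ refl       = all⇒sum≡1 T λ _ i∈S → i∈S
... | inj₂ (inj₁ Z∈l) = joined-swap p l r (lookup Z) (λ a f → f + a ≡ 1ℚ) refl refl (mass-none r nr) (flow-none r nr)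
  (trans (none-sum (mass (lookup Z) l) (flow (lookup Z) l)) (shore⇒sum≡1 l Z∈l))
  where
  nr : ConstOn false B (lookup Z)
  nr i i∈B = ⊆⇒lookup-false (∈ᵀ⇒⊆ l Z∈l) (split-disjointʳ (at p i) i∈B)
... | inj₂ (inj₂ Z∈r) = joined p l r (lookup Z) (λ a f → f + a ≡ 1ℚ) (mass-none l nl) (flow-none l nl) refl refl
  (trans (none-sum (mass (lookup Z) r) (flow (lookup Z) r)) (shore⇒sum≡1 r Z∈r))
  where
  nl : ConstOn false A (lookup Z)
  nl i i∈A = ⊆⇒lookup-false (∈ᵀ⇒⊆ r Z∈r) (split-disjointˡ (at p i) i∈A)

-- Cuts and their sides away from the root

-- Membership records separation from the vertex zero, so complementary shores give the same set.
away : ∀ {m} → Subset (suc m) → Subset m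
away X = tabulate λ j → inCut X zero (suc j)

xor-cancel : ∀ a b → a xor (a xor b) ≡ b
xor-cancel true  b = Boolₚ.not-involutive b
xor-cancel false b = refl

xor-cancel₂ : ∀ a b c → (a xor b) xor (a xor c) ≡ b xor c
xor-cancel₂ true  true  c = refl
xor-cancel₂ true  false c = Boolₚ.not-involutive c
xor-cancel₂ false b     c = refl

module _ {m : ℕ} where

  lookup-away : ∀ (X : Subset (suc m)) i → lookup (lift (away X)) i ≡ lookup X zero xor lookup X i
  lookup-away X zero    = sym (Boolₚ.xor-same (lookup X zero))
  lookup-away X (suc i) = Vecₚ.lookup∘tabulate (λ j → inCut X zero (suc j)) i

  inCut-away : ∀ (X : Subset (suc m)) i j → inCut X i j ≡ inCut (lift (away X)) i j
  inCut-away X i j rewrite lookup-away X i | lookup-away X j = sym (xor-cancel₂ (lookup X zero) (lookup X i) (lookup X j))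

  away-lift : ∀ (Z : Subset m) → away (lift Z) ≡ Z
  away-lift = Vecₚ.tabulate∘lookup

  sameCut⇒away≡ : ∀ (X Y : Subset (suc m)) → SameCut X Y → away X ≡ away Y
  sameCut⇒away≡ X Y same = Vecₚ.tabulate-cong λ j → same zero (suc j) (s≤s z≤n)

  away≡⇒inCut≡ : ∀ (X Y : Subset (suc m)) → away X ≡ away Y → ∀ i j → inCut X i j ≡ inCut Y i j
  away≡⇒inCut≡ X Y eq i j = begin
    inCut X i j                ≡⟨ inCut-away X i j ⟩
    inCut (lift (away X)) i j  ≡⟨ cong (λ Z → inCut (lift Z) i j) eq ⟩
    inCut (lift (away Y)) i j  ≡⟨ inCut-away Y i j ⟨
    inCut Y i j ∎
    where open ≡-Reasoning

  away≡⇒sameCut : ∀ (X Y : Subset (suc m)) → away X ≡ away Y → SameCut X Y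
  away≡⇒sameCut X Y eq i j _ = away≡⇒inCut≡ X Y eq i j

  proper⇒nonempty : ∀ {X : Subset (suc m)} → ProperShore X → Nonempty (away X)
  proper⇒nonempty {true ∷ X} (_ , suc j , there j∈) = j , Vecₚ.lookup⇒[]= j _
    (trans (lookup-away (true ∷ X) (suc j)) (trans (sym (Vecₚ.lookup-map j not X)) (Vecₚ.[]=⇒lookup j∈)))
  proper⇒nonempty {false ∷ X} ((suc i , there i∈) , _) = i , Vecₚ.lookup⇒[]= i _
    (trans (lookup-away (false ∷ X) (suc i)) (Vecₚ.[]=⇒lookup i∈))

  nonempty⇒proper : ∀ {Z : Subset m} → Nonempty Z → ProperShore (lift Z)
  nonempty⇒proper (i , i∈Z) = (suc i , there i∈Z) , zero , here

-- Crossing, with the four regions indexed by Booleans: complementing a shore then only permutes the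
-- indices by `xor`.
Quadrants : ∀ {n} → Subset n → Subset n → Set
Quadrants X Y = ∀ a b → ∃[ i ] lookup X i ≡ a × lookup Y i ≡ b

∈∁⇒lookup : ∀ {n} {X : Subset n} {i} → i ∈ ∁ X → lookup X i ≡ false
∈∁⇒lookup {X = X} {i} i∈ with lookup X i in eq
... | false = refl
... | true  = contradiction (Vecₚ.lookup⇒[]= i X eq) (Sub.x∈∁p⇒x∉p i∈)

lookup⇒∈∁ : ∀ {n} {X : Subset n} {i} → lookup X i ≡ false → i ∈ ∁ X
lookup⇒∈∁ {X = X} {i} eq = Sub.x∉p⇒x∈∁p λ i∈X → contradiction (trans (sym (Vecₚ.[]=⇒lookup i∈X)) eq) λ ()

cross⇒quadrants : ∀ {n} {X Y : Subset n} → Cross X Y → Quadrants X Y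
cross⇒quadrants {X = X} {Y} ((i , i∈) , _) true true with Sub.x∈p∩q⁻ X Y i∈
... | i∈X , i∈Y = i , Vecₚ.[]=⇒lookup i∈X , Vecₚ.[]=⇒lookup i∈Y
cross⇒quadrants {X = X} {Y} (_ , (i , i∈) , _) true false with Sub.x∈p∩q⁻ X (∁ Y) i∈
... | i∈X , i∉Y = i , Vecₚ.[]=⇒lookup i∈X , ∈∁⇒lookup i∉Y
cross⇒quadrants {X = X} {Y} (_ , _ , (i , i∈) , _) false true with Sub.x∈p∩q⁻ Y (∁ X) i∈
... | i∈Y , i∉X = i , ∈∁⇒lookup i∉X , Vecₚ.[]=⇒lookup i∈Y
cross⇒quadrants {X = X} {Y} (_ , _ , _ , i , i∈) false false =
  i , ∈∁⇒lookup (Sub.x∉p⇒x∈∁p λ i∈X → Sub.x∈∁p⇒x∉p i∈ (Sub.x∈p∪q⁺ (inj₁ i∈X)))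
    , ∈∁⇒lookup (Sub.x∉p⇒x∈∁p λ i∈Y → Sub.x∈∁p⇒x∉p i∈ (Sub.x∈p∪q⁺ (inj₂ i∈Y)))

quadrants⇒cross : ∀ {n} {X Y : Subset n} → Quadrants X Y → Cross X Y
quadrants⇒cross {X = X} {Y} q =
  meet X Y (q true true) (λ { (x , y) → Vecₚ.lookup⇒[]= _ X x , Vecₚ.lookup⇒[]= _ Y y }) ,
  meet X (∁ Y) (q true false) (λ { (x , y) → Vecₚ.lookup⇒[]= _ X x , lookup⇒∈∁ y }) ,
  meet Y (∁ X) (q false true) (λ { (x , y) → Vecₚ.lookup⇒[]= _ Y y , lookup⇒∈∁ x }) ,
  outside (q false false)
  where
  meet : ∀ A B {P : Fin _ → Set} → ∃ P → (∀ {i} → P i → i ∈ A × i ∈ B) → Nonempty (A ∩ B)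
  meet A B (i , p) f = i , Sub.x∈p∩q⁺ (f p)
  outside : ∃[ i ] lookup X i ≡ false × lookup Y i ≡ false → Nonempty (∁ (X ∪ Y))
  outside (i , x , y) = i , Sub.x∉p⇒x∈∁p λ i∈ →
    [ Sub.x∈∁p⇒x∉p (lookup⇒∈∁ {X = X} x) , Sub.x∈∁p⇒x∉p (lookup⇒∈∁ {X = Y} y) ]′ (Sub.x∈p∪q⁻ X Y i∈)

module _ {m : ℕ} {X Y : Subset (suc m)} where

  quadrants-away : Quadrants X Y → Quadrants (lift (away X)) (lift (away Y))
  quadrants-away q a b with q (lookup X zero xor a) (lookup Y zero xor b)
  ... | i , x , y = i , trans (lookup-away X i) (trans (cong (lookup X zero xor_) x) (xor-cancel (lookup X zero) a))
                      , trans (lookup-away Y i) (trans (cong (lookup Y zero xor_) y) (xor-cancel (lookup Y zero) b))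

  quadrants-away⁻ : Quadrants (lift (away X)) (lift (away Y)) → Quadrants X Y
  quadrants-away⁻ q a b with q (lookup X zero xor a) (lookup Y zero xor b)
  ... | i , x , y = i , undo X x , undo Y y
    where
    undo : ∀ (V : Subset (suc m)) {c} → lookup (lift (away V)) i ≡ lookup V zero xor c → lookup V i ≡ c
    undo V {c} eq = begin
      lookup V i                                       ≡⟨ xor-cancel (lookup V zero) (lookup V i) ⟨
      lookup V zero xor (lookup V zero xor lookup V i) ≡⟨ cong (lookup V zero xor_) (trans (sym (lookup-away V i)) eq) ⟩
      lookup V zero xor (lookup V zero xor c)          ≡⟨ xor-cancel (lookup V zero) c ⟩
      c ∎
      where open ≡-Reasoning

laminar⇒¬quadrants : ∀ {m} {A B : Subset m} → Laminar A B → ¬ Quadrants (lift A) (lift B)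
laminar⇒¬quadrants {A = A} {B} (inj₁ disj) q with q true true
... | suc i , a , b = disj (Vecₚ.lookup⇒[]= i A a) (Vecₚ.lookup⇒[]= i B b)
laminar⇒¬quadrants {A = A} {B} (inj₂ (inj₁ A⊆B)) q with q true false
... | suc i , a , b = contradiction (trans (sym (Vecₚ.[]=⇒lookup (A⊆B (Vecₚ.lookup⇒[]= i A a)))) b) λ ()
laminar⇒¬quadrants {A = A} {B} (inj₂ (inj₂ B⊆A)) q with q false true
... | suc i , a , b = contradiction (trans (sym (Vecₚ.[]=⇒lookup (B⊆A (Vecₚ.lookup⇒[]= i B b)))) a) λ ()

∖-empty⇒⊆ : ∀ {m} {A B : Subset m} → ¬ Nonempty (A ∩ ∁ B) → A ⊆ B
∖-empty⇒⊆ {B = B} empty {x} x∈A with x Sub.∈? B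
... | yes x∈B = x∈B
... | no  x∉B = contradiction (x , Sub.x∈p∩q⁺ (x∈A , Sub.x∉p⇒x∈∁p x∉B)) empty

-- The vertex zero always lies outside both lifted sets, so only the other three regions can be
-- empty, and each of them gives one alternative of `Laminar`.
¬quadrants⇒laminar : ∀ {m} (A B : Subset m) → ¬ Quadrants (lift A) (lift B) → Laminar A B
¬quadrants⇒laminar A B ¬q with Sub.nonempty? (A ∩ B) | Sub.nonempty? (A ∩ ∁ B) | Sub.nonempty? (B ∩ ∁ A)
... | no empty | _        | _        = inj₁ λ x∈A x∈B → empty (_ , Sub.x∈p∩q⁺ (x∈A , x∈B))
... | _        | no empty | _        = inj₂ (inj₁ (∖-empty⇒⊆ empty))
... | _        | _        | no empty = inj₂ (inj₂ (∖-empty⇒⊆ empty))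
... | yes (i , i∈) | yes (j , j∈) | yes (k , k∈) = contradiction
  (cross⇒quadrants ((suc i , there i∈) , (suc j , there j∈) , (suc k , there k∈) , zero , here)) ¬q

distinct⇒proper : ∀ {n} {L : List (Subset n)} → DistinctCuts L → ∀ {X} → X ∈ₗ L → ProperShore X
distinct⇒proper ((proper , _) ∷ _) (here refl) = proper
distinct⇒proper (_ ∷ distinct)     (there X∈L) = distinct⇒proper distinct X∈L

distinct⇒unique : ∀ {m} {L : List (Subset (suc m))} → DistinctCuts L → Unique (List.map away L)
distinct⇒unique []                  = LAllPairs.[]
distinct⇒unique {L = X ∷ L} ((_ , X∉) ∷ distinct) =
  Allₚ.map⁺ (Allₚ.¬Any⇒All¬ L (X∉ ∘ Any.map (λ {Y} → away≡⇒sameCut X Y))) LAllPairs.∷ distinct⇒unique distinct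

module _ {m : ℕ} {L : List (Subset (suc m))} (maxL : MaximalCrossFree L) where

  private
    distinct  = proj₁ maxL
    crossFree : CrossFree L
    crossFree = proj₁ (proj₂ maxL)

  -- Crossing is insensitive to the choice of shores, and for sides away from the vertex zero it is
  -- exactly the failure of laminarity. Maximality transfers because equal cuts have equal sides.
  crossFree⇒laminar : MaximalLaminar (List.map away L)
  crossFree⇒laminar .MaximalLaminar.nonempty A∈ with Memₚ.∈-map⁻ away A∈
  ... | X , X∈L , refl = proper⇒nonempty (distinct⇒proper distinct X∈L)
  crossFree⇒laminar .MaximalLaminar.laminar A∈ B∈ with Memₚ.∈-map⁻ away A∈ | Memₚ.∈-map⁻ away B∈
  ... | X , X∈L , refl | Y , Y∈L , refl = ¬quadrants⇒laminar (away X) (away Y)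
    (crossFree X∈L Y∈L ∘ quadrants⇒cross ∘ quadrants-away⁻ {X = X} {Y})
  crossFree⇒laminar .MaximalLaminar.maximal {Z} Z-nonempty lam = Anyₚ.map⁺
    (Any.map (λ {X} same → trans (sym (away-lift Z)) (sameCut⇒away≡ (lift Z) X same))
      (proj₂ (proj₂ maxL) (lift Z) (nonempty⇒proper Z-nonempty) ¬cross))
    where
    ¬cross : ∀ {X} → X ∈ₗ L → ¬ Cross X (lift Z)
    ¬cross {X} X∈L cross = laminar⇒¬quadrants (lam (Memₚ.∈-map⁺ away X∈L))
      (subst (λ V → Quadrants (lift (away X)) (lift V)) (away-lift Z) (quadrants-away {X = X} {lift Z} (cross⇒quadrants cross)))

-- Linear independence

module _ {m : ℕ} where

  -- The total coefficient of the sets that contain both `i` and `j`.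
  both : ∀ {k} → Vec ℚ k → Vec (Subset m) k → Fin m → Fin m → ℚ
  both []       []       i j = 0ℚ
  both (c ∷ cs) (Z ∷ Zs) i j = c · ⟦ lookup Z i ∧ lookup Z j ⟧ + both cs Zs i j

  both-sym : ∀ {k} (cs : Vec ℚ k) Zs i j → both cs Zs i j ≡ both cs Zs j i
  both-sym []       []       i j = refl
  both-sym (c ∷ cs) (Z ∷ Zs) i j =
    cong₂ (λ b q → c · ⟦ b ⟧ + q) (Boolₚ.∧-comm (lookup Z i) (lookup Z j)) (both-sym cs Zs i j)

  both-++ : ∀ {k l} (cs : Vec ℚ k) (ds : Vec ℚ l) Zs Ys i j →
    both (cs Vec.++ ds) (Zs Vec.++ Ys) i j ≡ both cs Zs i j + both ds Ys i j
  both-++ []       ds []       Ys i j = sym (ℚₚ.+-identityˡ (both ds Ys i j))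
  both-++ (c ∷ cs) ds (Z ∷ Zs) Ys i j =
    trans (cong (c · ⟦ lookup Z i ∧ lookup Z j ⟧ +_) (both-++ cs ds Zs Ys i j))
      (sym (ℚₚ.+-assoc (c · ⟦ lookup Z i ∧ lookup Z j ⟧) (both cs Zs i j) (both ds Ys i j)))

  lincomb-root : ∀ {k} (cs : Vec ℚ k) Zs i → lincomb cs (Vec.map lift Zs) zero (suc i) ≡ both cs Zs i i
  lincomb-root []       []       i = refl
  lincomb-root (c ∷ cs) (Z ∷ Zs) i =
    cong₂ (λ b q → c · ⟦ b ⟧ + q) (sym (Boolₚ.∧-idem (lookup Z i))) (lincomb-root cs Zs i)

  -- χ_Z(i,j) = [i ∈ Z] + [j ∈ Z] − 2 [i, j ∈ Z], with the subtracted term moved to the left.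
  lincomb-pair : ∀ {k} (cs : Vec ℚ k) Zs i j →
    lincomb cs (Vec.map lift Zs) (suc i) (suc j) + (both cs Zs i j + both cs Zs i j) ≡ both cs Zs i i + both cs Zs j j
  lincomb-pair []       []       i j = refl
  lincomb-pair (c ∷ cs) (Z ∷ Zs) i j =
    trans (regroup₁ (c · ⟦ a xor b ⟧) (lincomb cs (Vec.map lift Zs) (suc i) (suc j)) (c · ⟦ a ∧ b ⟧) (both cs Zs i j))
      (trans (cong₂ _+_ (entry a b c) (lincomb-pair cs Zs i j))
        (regroup₂ (c · ⟦ a ∧ a ⟧) (c · ⟦ b ∧ b ⟧) (both cs Zs i i) (both cs Zs j j)))
    where
    a = lookup Z i
    b = lookup Z j
    regroup₁ : ∀ u p v q → (u + p) + ((v + q) + (v + q)) ≡ (u + (v + v)) + (p + (q + q))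
    regroup₁ = solve 4 (λ u p v q → (u :+ p) :+ ((v :+ q) :+ (v :+ q)) := (u :+ (v :+ v)) :+ (p :+ (q :+ q))) refl
    regroup₂ : ∀ u v p q → (u + v) + (p + q) ≡ (u + p) + (v + q)
    regroup₂ = solve 4 (λ u v p q → (u :+ v) :+ (p :+ q) := (u :+ p) :+ (v :+ q)) refl
    entry : ∀ a b c → c · ⟦ a xor b ⟧ + (c · ⟦ a ∧ b ⟧ + c · ⟦ a ∧ b ⟧) ≡ c · ⟦ a ∧ a ⟧ + c · ⟦ b ∧ b ⟧
    entry true  true  = solve 1 (λ c → c :* con 0ℚ :+ (c :* con 1ℚ :+ c :* con 1ℚ) := c :* con 1ℚ :+ c :* con 1ℚ) refl
    entry true  false = solve 1 (λ c → c :* con 1ℚ :+ (c :* con 0ℚ :+ c :* con 0ℚ) := c :* con 1ℚ :+ c :* con 0ℚ) refl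
    entry false true  = solve 1 (λ c → c :* con 1ℚ :+ (c :* con 0ℚ :+ c :* con 0ℚ) := c :* con 0ℚ :+ c :* con 1ℚ) refl
    entry false false = solve 1 (λ c → c :* con 0ℚ :+ (c :* con 0ℚ :+ c :* con 0ℚ) := c :* con 0ℚ :+ c :* con 0ℚ) refl

  double-zero : ∀ {q} → q + q ≡ 0ℚ → q ≡ 0ℚ
  double-zero {q} eq = trans (halve q) (cong (½ ·_) eq)
    where
    halve : ∀ q → q ≡ ½ · (q + q)
    halve = solve 1 (λ q → q := con ½ :* (q :+ q)) refl

  lincomb-sym : ∀ {n k} (cs : Vec ℚ k) (Xs : Vec (Subset n) k) i j → lincomb cs Xs i j ≡ lincomb cs Xs j i
  lincomb-sym []       []       i j = refl
  lincomb-sym (c ∷ cs) (X ∷ Xs) i j =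
    cong₂ (λ b q → c · ⟦ b ⟧ + q) (xor-comm (lookup X i) (lookup X j)) (lincomb-sym cs Xs i j)

  -- Pairs with the vertex zero give the diagonal values; `lincomb-pair` then yields twice each
  -- off-diagonal value.
  both-zero : ∀ {k} (cs : Vec ℚ k) Zs → (∀ i j → i Fin.< j → lincomb cs (Vec.map lift Zs) i j ≡ 0ℚ) →
    ∀ i j → both cs Zs i j ≡ 0ℚ
  both-zero cs Zs zeros i j = cases (Finₚ.<-cmp i j)
    where
    open import Relation.Binary.Definitions using (Tri; tri<; tri≈; tri>)
    diagonal : ∀ i → both cs Zs i i ≡ 0ℚ
    diagonal i = trans (sym (lincomb-root cs Zs i)) (zeros zero (suc i) (s≤s z≤n))
    off : lincomb cs (Vec.map lift Zs) (suc i) (suc j) ≡ 0ℚ → both cs Zs i j ≡ 0ℚ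
    off eq = double-zero (begin
      b + b         ≡⟨ ℚₚ.+-identityˡ (b + b) ⟨
      0ℚ + (b + b)  ≡⟨ cong (_+ (b + b)) eq ⟨
      lincomb cs (Vec.map lift Zs) (suc i) (suc j) + (b + b) ≡⟨ lincomb-pair cs Zs i j ⟩
      both cs Zs i i + both cs Zs j j ≡⟨ cong₂ _+_ (diagonal i) (diagonal j) ⟩
      0ℚ ∎)
      where
      open ≡-Reasoning
      b = both cs Zs i j
    cases : Tri (i Fin.< j) (i ≡ j) (j Fin.< i) → both cs Zs i j ≡ 0ℚ
    cases (tri< i<j _ _)  = off (zeros (suc i) (suc j) (s≤s i<j))
    cases (tri≈ _ refl _) = diagonal i
    cases (tri> _ _ j<i)  = off (trans (lincomb-sym cs (Vec.map lift Zs) (suc i) (suc j)) (zeros (suc j) (suc i) (s≤s j<i)))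

  both-outside : ∀ {S} (T : Tree S) cs {i} → lookup S i ≡ false → ∀ j → both cs (nodes T) i j ≡ 0ℚ
  both-outside (leaf k) (c ∷ []) i∉S j rewrite i∉S | ℚₚ.*-zeroʳ c = refl
  both-outside (node p l r) (c ∷ cs) {i} i∉S j with Vec.splitAt (size l) cs
  ... | cl , cr , refl rewrite both-++ cl cr (nodes l) (nodes r) i j | i∉S | ℚₚ.*-zeroʳ c
    | both-outside l cl (split-outˡ (at p i) i∉S) j | both-outside r cr (split-outʳ (at p i) i∉S) j = refl

  -- The hypothesis concerns only pairs inside `S`. Once the root coefficient is gone it passes to
  -- each child, because pairs inside one child lie in no node of the other.
  tree-independent : ∀ {S} (T : Tree S) (cs : Vec ℚ (size T)) →
    (∀ i j → lookup S i ≡ true → lookup S j ≡ true → both cs (nodes T) i j ≡ 0ℚ) → VAll.All (_≡ 0ℚ) cs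
  tree-independent (leaf k) (c ∷ []) zeros = c≡0 VAll.∷ VAll.[]
    where
    k∈ = Vecₚ.[]=⇒lookup (Sub.x∈⁅x⁆ k)
    c≡0 : c ≡ 0ℚ
    c≡0 = trans (sym (trans (cong₂ (λ a b → c · ⟦ a ∧ b ⟧ + 0ℚ) k∈ k∈) (trans (ℚₚ.+-identityʳ (c · 1ℚ)) (ℚₚ.*-identityʳ c))))
      (zeros k k k∈ k∈)
  tree-independent (node {S} {A} {B} p l r) (c ∷ cs) zeros with Vec.splitAt (size l) cs
  ... | cl , cr , refl = c≡0 VAll.∷ VAllₚ.++⁺ (tree-independent l cl zerosˡ) (tree-independent r cr zerosʳ)
    where
    open ≡-Reasoning
    total : ∀ i j → lookup S i ≡ true → lookup S j ≡ true → c + (both cl (nodes l) i j + both cr (nodes r) i j) ≡ 0ℚ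
    total i j i∈S j∈S = begin
      c + (both cl (nodes l) i j + both cr (nodes r) i j)
        ≡⟨ cong₂ _+_ (sym (ℚₚ.*-identityʳ c)) (sym (both-++ cl cr (nodes l) (nodes r) i j)) ⟩
      c · ⟦ true ∧ true ⟧ + both (cl Vec.++ cr) (nodes l Vec.++ nodes r) i j
        ≡⟨ cong₂ (λ a b → c · ⟦ a ∧ b ⟧ + both (cl Vec.++ cr) (nodes l Vec.++ nodes r) i j) i∈S j∈S ⟨
      c · ⟦ lookup S i ∧ lookup S j ⟧ + both (cl Vec.++ cr) (nodes l Vec.++ nodes r) i j
        ≡⟨ zeros i j i∈S j∈S ⟩
      0ℚ ∎
    -- A pair with one vertex in A and one in B lies in no node below S.
    c≡0 : c ≡ 0ℚ
    c≡0 with tree-nonempty l | tree-nonempty r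
    ... | i , i∈A | j , j∈B = begin
      c ≡⟨ ℚₚ.+-identityʳ c ⟨
      c + (0ℚ + 0ℚ) ≡⟨ cong₂ (λ u v → c + (u + v))
        (trans (both-sym cl (nodes l) i j) (both-outside l cl (split-disjointʳ (at p j) j∈ʳ) i))
        (both-outside r cr (split-disjointˡ (at p i) i∈ˡ) j) ⟨
      c + (both cl (nodes l) i j + both cr (nodes r) i j)
        ≡⟨ total i j (split-left (at p i) i∈ˡ) (split-right (at p j) j∈ʳ) ⟩
      0ℚ ∎
      where
      i∈ˡ = Vecₚ.[]=⇒lookup i∈A
      j∈ʳ = Vecₚ.[]=⇒lookup j∈B
    children : ∀ i j → lookup S i ≡ true → lookup S j ≡ true → both cl (nodes l) i j + both cr (nodes r) i j ≡ 0ℚ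
    children i j i∈S j∈S = begin
      both cl (nodes l) i j + both cr (nodes r) i j        ≡⟨ ℚₚ.+-identityˡ _ ⟨
      0ℚ + (both cl (nodes l) i j + both cr (nodes r) i j) ≡⟨ cong (_+ (both cl (nodes l) i j + both cr (nodes r) i j)) c≡0 ⟨
      c + (both cl (nodes l) i j + both cr (nodes r) i j)  ≡⟨ total i j i∈S j∈S ⟩
      0ℚ ∎
    zerosˡ : ∀ i j → lookup A i ≡ true → lookup A j ≡ true → both cl (nodes l) i j ≡ 0ℚ
    zerosˡ i j i∈A j∈A = begin
      both cl (nodes l) i j      ≡⟨ ℚₚ.+-identityʳ _ ⟨
      both cl (nodes l) i j + 0ℚ ≡⟨ cong (both cl (nodes l) i j +_) (both-outside r cr (split-disjointˡ (at p i) i∈A) j) ⟨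
      both cl (nodes l) i j + both cr (nodes r) i j ≡⟨ children i j (split-left (at p i) i∈A) (split-left (at p j) j∈A) ⟩
      0ℚ ∎
    zerosʳ : ∀ i j → lookup B i ≡ true → lookup B j ≡ true → both cr (nodes r) i j ≡ 0ℚ
    zerosʳ i j i∈B j∈B = begin
      both cr (nodes r) i j      ≡⟨ ℚₚ.+-identityˡ _ ⟨
      0ℚ + both cr (nodes r) i j ≡⟨ cong (_+ both cr (nodes r) i j) (both-outside l cl (split-disjointʳ (at p i) i∈B) j) ⟨
      both cl (nodes l) i j + both cr (nodes r) i j ≡⟨ children i j (split-right (at p i) i∈B) (split-right (at p j) j∈B) ⟩
      0ℚ ∎

  nodes-linIndep : ∀ {S} (T : Tree S) → LinIndep (Vec.map lift (nodes T))
  nodes-linIndep T cs zeros = tree-independent T cs λ i j _ _ → both-zero cs (nodes T) zeros i j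

-- Bounding the size of an independent family of cuts

module _ {n : ℕ} where

  lincomb-0 : ∀ {k} (Xs : Vec (Subset n) k) i j → lincomb (Vec.replicate k 0ℚ) Xs i j ≡ 0ℚ
  lincomb-0 []       i j = refl
  lincomb-0 (X ∷ Xs) i j = trans (cong₂ _+_ (ℚₚ.*-zeroˡ (χ X i j)) (lincomb-0 Xs i j)) refl

  linIndep-tail : ∀ {k X} {Xs : Vec (Subset n) k} → LinIndep (X ∷ Xs) → LinIndep Xs
  linIndep-tail {X = X} indep cs zeros = VAll.tail (indep (0ℚ ∷ cs) λ i j i<j →
    cong₂ _+_ (ℚₚ.*-zeroˡ (χ X i j)) (zeros i j i<j))

  selector : ∀ {k} X {Xs : Vec (Subset n) k} → VAny.Any (SameCut X) Xs → Vec ℚ k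
  selector {suc k} X (VAny.here _)  = - 1ℚ ∷ Vec.replicate k 0ℚ
  selector         X (VAny.there p) = 0ℚ ∷ selector X p

  lincomb-selector : ∀ {k} X {Xs : Vec (Subset n) k} (p : VAny.Any (SameCut X) Xs) →
    ∀ i j → i Fin.< j → lincomb (selector X p) Xs i j ≡ - 1ℚ · χ X i j
  lincomb-selector X {Y ∷ Xs} (VAny.here same) i j i<j = trans
    (cong₂ (λ b q → - 1ℚ · ⟦ b ⟧ + q) (sym (same i j i<j)) (lincomb-0 Xs i j)) (ℚₚ.+-identityʳ (- 1ℚ · χ X i j))
  lincomb-selector X {Y ∷ Xs} (VAny.there p) i j i<j = trans
    (cong₂ _+_ (ℚₚ.*-zeroˡ (χ Y i j)) (lincomb-selector X p i j i<j)) (ℚₚ.+-identityˡ (- 1ℚ · χ X i j))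

  -- A second occurrence of the cut gives the relation that takes it once with coefficient one and
  -- once with minus one.
  linIndep-fresh : ∀ {k X} {Xs : Vec (Subset n) k} → LinIndep (X ∷ Xs) → ¬ VAny.Any (SameCut X) Xs
  linIndep-fresh {X = X} {Xs} indep p = contradiction (VAll.head (indep (1ℚ ∷ selector X p) relation)) λ ()
    where
    cancel : ∀ q → 1ℚ · q + - 1ℚ · q ≡ 0ℚ
    cancel = solve 1 (λ q → con 1ℚ :* q :+ con (- 1ℚ) :* q := con 0ℚ) refl
    relation : ∀ i j → i Fin.< j → lincomb (1ℚ ∷ selector X p) (X ∷ Xs) i j ≡ 0ℚ
    relation i j i<j = trans (cong (1ℚ · χ X i j +_) (lincomb-selector X p i j i<j)) (cancel (χ X i j))

linIndep⇒unique : ∀ {m k} (Xs : Vec (Subset (suc m)) k) → LinIndep Xs → VUnique.Unique (Vec.map away Xs)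
linIndep⇒unique []       indep = VAllPairs.[]
linIndep⇒unique (X ∷ Xs) indep = fresh Xs (linIndep-fresh indep) VAllPairs.∷ linIndep⇒unique Xs (linIndep-tail indep)
  where
  fresh : ∀ {k} (Ys : Vec _ k) → ¬ VAny.Any (SameCut X) Ys → VAll.All (away X ≢_) (Vec.map away Ys)
  fresh []       _    = VAll.[]
  fresh (Y ∷ Ys) ¬any = (λ eq → ¬any (VAny.here (away≡⇒sameCut X Y eq))) VAll.∷ fresh Ys (¬any ∘ VAny.there)

toList-unique : ∀ {A : Set} {k} {xs : Vec A k} → VUnique.Unique xs → Unique (toList xs)
toList-unique VAllPairs.[]         = LAllPairs.[]
toList-unique (px VAllPairs.∷ pxs) = VAllₚ.toList⁺ px LAllPairs.∷ toList-unique pxs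

-- Read off from independence: a repeated node would give a linear relation.
nodes-unique : ∀ {m} {S : Subset m} (T : Tree S) → Unique (toList (nodes T))
nodes-unique T = toList-unique (subst VUnique.Unique away-nodes (linIndep⇒unique (Vec.map lift (nodes T)) (nodes-linIndep T)))
  where
  away-nodes : Vec.map away (Vec.map lift (nodes T)) ≡ nodes T
  away-nodes = trans (sym (Vecₚ.map-∘ away lift (nodes T))) (trans (Vecₚ.map-cong away-lift (nodes T)) (Vecₚ.map-id (nodes T)))

unique-⊆⇒≤ : ∀ {A : Set} {k l} {xs : Vec A k} {ys : Vec A l} → VUnique.Unique xs → (∀ i → lookup xs i VMem.∈ ys) → k ≤ l
unique-⊆⇒≤ {ys = ys} unique xs⊆ys = Finₚ.injective⇒≤ {f = λ i → VAny.index (xs⊆ys i)} λ {i} {j} eq →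
  VUniqueₚ.lookup-injective unique i j
    (trans (VAnyₚ.lookup-index (xs⊆ys i)) (trans (cong (lookup ys) eq) (sym (VAnyₚ.lookup-index (xs⊆ys j)))))

-- Minimum cuts and dimension for the given family

count-away : ∀ {m} (L : List (Subset (suc m))) i j → count L i j ≡ count (List.map lift (List.map away L)) i j
count-away []      i j = refl
count-away (X ∷ L) i j = cong₂ (λ b k → (if b then 1 else 0) ℕ.+ k) (inCut-away X i j) (count-away L i j)

count-↭ : ∀ {n} {K L : List (Subset n)} → K ↭ L → ∀ i j → count K i j ≡ count L i j
count-↭ Perm.refl          i j = refl
count-↭ (Perm.prep X p)    i j = cong ((if inCut X i j then 1 else 0) ℕ.+_) (count-↭ p i j)
count-↭ (Perm.swap {xs} {ys} X Y p) i j = trans (cong (λ k → a ℕ.+ (b ℕ.+ k)) (count-↭ p i j)) (Comm.x∙yz≈y∙xz a b (count ys i j))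
  where
  a = if inCut X i j then 1 else 0
  b = if inCut Y i j then 1 else 0
count-↭ (Perm.trans p q)   i j = trans (count-↭ p i j) (count-↭ q i j)

half^-pos : ∀ k → 0ℚ < half^ k
half^-pos zero    = ℚₚ.positive⁻¹ 1ℚ
half^-pos (suc k) = 0<* 0<½ (half^-pos k)

weightFn-pos : ∀ {n} (L : List (Subset n)) → Complete (weightFn L)
weightFn-pos L i j _ = 0<* (ℚₚ.positive⁻¹ (1ℚ + 1ℚ)) (half^-pos (count L i j))

lookup-injective : ∀ {A : Set} {n} {xs ys : Vec A n} → (∀ i → lookup xs i ≡ lookup ys i) → xs ≡ ys
lookup-injective {xs = xs} {ys} eq = begin
  xs                   ≡⟨ Vecₚ.tabulate∘lookup xs ⟨
  tabulate (lookup xs) ≡⟨ Vecₚ.tabulate-cong eq ⟩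
  tabulate (lookup ys) ≡⟨ Vecₚ.tabulate∘lookup ys ⟩
  ys ∎
  where open ≡-Reasoning

size-⊤ : ∀ {m} (T : Tree {m} ⊤) → size T ≡ 2 * suc m ∸ 3
-- `(3 ℕ.+ size T) ∸ 3` computes to `size T`, so the chain below needs no truncated subtraction.
size-⊤ {m} T = cong (_∸ 3) (begin
  3 ℕ.+ size T                    ≡⟨ cong (2 ℕ.+_) (suc-size T) ⟩
  2 ℕ.+ (∣ ⊤ {m} ∣ ℕ.+ ∣ ⊤ {m} ∣) ≡⟨ cong (λ k → 2 ℕ.+ (k ℕ.+ k)) (Sub.∣⊤∣≡n m) ⟩
  2 ℕ.+ (m ℕ.+ m)                 ≡⟨ cong suc (ℕₚ.+-suc m m) ⟨
  suc m ℕ.+ suc m                 ≡⟨ cong (suc m ℕ.+_) (ℕₚ.+-identityʳ (suc m)) ⟨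
  2 * suc m ∎)
  where open ≡-Reasoning

cutWeight-cut : ∀ {n} (w u : Weight n) (X : Subset n) (x : Fin n → Bool) →
  (∀ i j → inCut X i j ≡ x i xor x j) → (∀ i j → w i j ≡ u i j) → (∀ i j → u i j ≡ u j i) →
  cutWeight w X ≡ sum (λ i → sum (λ j → ⟦ x i ⟧ · (⟦ not (x j) ⟧ · u i j)))
cutWeight-cut w u X x X≡x w≡u u-sym = trans
  (sumPairs-cong {f = λ i j → χ X i j · w i j} {g = λ i j → ⟦ x i xor x j ⟧ · u i j}
    (λ i j → cong₂ (λ b q → ⟦ b ⟧ · q) (X≡x i j) (w≡u i j)))
  (sumPairs-cut x u u-sym)

treeWeight : ∀ {m} {S : Subset m} → Tree S → Weight (suc m)
treeWeight T i j = weight (treeCount T i j)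

treeWeight-sym : ∀ {m} {S : Subset m} (T : Tree S) i j → treeWeight T i j ≡ treeWeight T j i
treeWeight-sym T i j = cong weight (count-sym (List.map lift (toList (nodes T))) i j)

-- An ordered pair leaving `lift Z` ends at the vertex zero, counted by the mass, or at another
-- vertex, counted by the flow. The row of the vertex zero vanishes, as it lies outside `lift Z`.
cut-flow : ∀ {m} (T : Tree {m} ⊤) (Z : Subset m) →
  sum (λ i → sum (λ j → ⟦ lookup (lift Z) i ⟧ · (⟦ not (lookup (lift Z) j) ⟧ · treeWeight T i j)))
    ≡ flow (lookup Z) T + mass (lookup Z) T
cut-flow {m} T Z = begin
  sum (e zero) + sum (λ i → e (suc i) zero + sum (λ j → e (suc i) (suc j)))
    ≡⟨ cong₂ _+_ (sum-zero (e zero) (λ j → ℚₚ.*-zeroˡ (⟦ not (lookup (lift Z) j) ⟧ · treeWeight T zero j)))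
                 (sum-cong-≗ (λ i → cong₂ _+_ (column i) (sum-cong-≗ (row i)))) ⟩
  0ℚ + sum (λ i → massAt x T i + sum (flowAt x T i))
    ≡⟨ cong (0ℚ +_) (∑-distrib-+ (massAt x T) (λ i → sum (flowAt x T i))) ⟩
  0ℚ + (mass x T + flow x T)
    ≡⟨ trans (ℚₚ.+-identityˡ (mass x T + flow x T)) (ℚₚ.+-comm (mass x T) (flow x T)) ⟩
  flow x T + mass x T ∎
  where
  open ≡-Reasoning
  x = lookup Z
  e : Fin (suc m) → Fin (suc m) → ℚ
  e i j = ⟦ lookup (lift Z) i ⟧ · (⟦ not (lookup (lift Z) j) ⟧ · treeWeight T i j)
  ⊤-∧ : ∀ i b → b ≡ lookup ⊤ i ∧ b
  ⊤-∧ i b = cong (_∧ b) (sym (Vecₚ.lookup-replicate i true))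
  column : ∀ i → e (suc i) zero ≡ massAt x T i
  column i = cong₂ (λ b q → ⟦ b ⟧ · q) (⊤-∧ i (x i))
    (trans (ℚₚ.*-identityˡ (treeWeight T (suc i) zero)) (treeWeight-sym T (suc i) zero))
  row : ∀ i j → e (suc i) (suc j) ≡ flowAt x T i j
  row i j = cong₂ (λ b c → ⟦ b ⟧ · (⟦ c ⟧ · treeWeight T (suc i) (suc j))) (⊤-∧ i (x i)) (⊤-∧ j (not (x j)))

proper⇒¬none : ∀ {m} (X : Subset (suc m)) → ProperShore X → ¬ ConstOn {m} false ⊤ (lookup (away X))
proper⇒¬none X proper noneS with proper⇒nonempty {X = X} proper
... | i , i∈ = contradiction (trans (sym (Vecₚ.[]=⇒lookup i∈)) (noneS i (Vecₚ.lookup-replicate i true))) λ ()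

isShore⇒∈ : ∀ {m} (T : Tree {m} ⊤) Z → IsShore T (lookup Z) → Z ∈ᵀ T
isShore⇒∈ T Z (Y , Y∈T , agree) =
  subst (_∈ᵀ T) (sym (lookup-injective λ i → agree i (Vecₚ.lookup-replicate i true))) Y∈T

module _ {m : ℕ} (L : List (Subset (suc m))) (T : Tree {m} ⊤)
         (L↭T : List.map away L ↭ toList (nodes T)) where

  private
    w = weightFn L

  -- Counts depend on the shores only through their cuts and not on the order of the list.
  weightFn-tree : ∀ i j → w i j ≡ treeWeight T i j
  weightFn-tree i j = trans
    (cong (λ k → (1ℚ + 1ℚ) · half^ k) (trans (count-away L i j) (count-↭ (Permₚ.map⁺ lift L↭T) i j)))
    (sym (weight-def (treeCount T i j)))

  cutWeight-tree : ∀ X → cutWeight w X ≡ flow (lookup (away X)) T + mass (lookup (away X)) T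
  cutWeight-tree X = trans
    (cutWeight-cut w (treeWeight T) X (lookup (lift (away X))) (inCut-away X) weightFn-tree (treeWeight-sym T))
    (cut-flow T (away X))

  cutWeight≥1 : ∀ X → ProperShore X → 1ℚ ℚ.≤ cutWeight w X
  cutWeight≥1 X proper = subst (1ℚ ℚ.≤_) (sym (cutWeight-tree X)) (sum≥1 T (proper⇒¬none X proper))

  shore⇒cutWeight≡1 : ∀ X → away X ∈ᵀ T → cutWeight w X ≡ 1ℚ
  shore⇒cutWeight≡1 X X∈T = trans (cutWeight-tree X) (shore⇒sum≡1 T X∈T)

  shore⇒minCut : ∀ X → ProperShore X → away X ∈ᵀ T → IsMinCut w X
  shore⇒minCut X proper X∈T = proper , λ Y properY →
    subst (ℚ._≤ cutWeight w Y) (sym (shore⇒cutWeight≡1 X X∈T)) (cutWeight≥1 Y properY)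

  -- The cut isolating the vertex zero comes from the root of the tree and has weight one, so the
  -- lower bound one is attained.
  minCut⇒cutWeight≡1 : ∀ X → IsMinCut w X → cutWeight w X ≡ 1ℚ
  minCut⇒cutWeight≡1 X (proper , minimal) = ℚₚ.≤-antisym
    (subst (cutWeight w X ℚ.≤_) root-weight (minimal (lift ⊤) (nonempty⇒proper (tree-nonempty T))))
    (cutWeight≥1 X proper)
    where
    root-weight : cutWeight w (lift ⊤) ≡ 1ℚ
    root-weight = shore⇒cutWeight≡1 (lift ⊤) (subst (_∈ᵀ T) (sym (away-lift ⊤)) (root∈ T))

  minCut⇒shore : ∀ X → IsMinCut w X → away X ∈ᵀ T
  minCut⇒shore X min = isShore⇒∈ T (away X)
    (sum≡1⇒shore T (proper⇒¬none X (proj₁ min)) (trans (sym (cutWeight-tree X)) (minCut⇒cutWeight≡1 X min)))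

  minCutsAre : MinCutsAre w L
  minCutsAre X proper =
    (λ min → Any.map (λ {Y} → away≡⇒sameCut X Y)
      (Anyₚ.map⁻ (Permₚ.∈-resp-↭ (Perm.↭-sym L↭T) (minCut⇒shore X min)))) ,
    λ X∈L → shore⇒minCut X proper (Permₚ.∈-resp-↭ L↭T (Anyₚ.map⁺ (Any.map (λ {Y} → sameCut⇒away≡ X Y) X∈L)))

  -- The nodes give an independent family of minimum cuts. Any other such family consists of
  -- distinct cuts whose sides away from the vertex zero are nodes, so it is no longer.
  cdim : CDim w (size T)
  cdim = (Vec.map lift (nodes T) , minCuts , nodes-linIndep T) , bound
    where
    minCuts : VAll.All (IsMinCut w) (Vec.map lift (nodes T))
    minCuts = VAllₚ.map⁺ (VAllₚ.toList⁻ (All.tabulate λ {Z} Z∈T →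
      shore⇒minCut (lift Z) (nonempty⇒proper (∈ᵀ⇒nonempty T Z∈T)) (subst (_∈ᵀ T) (sym (away-lift Z)) Z∈T)))
    bound : ∀ k (Xs : Vec (Subset (suc m)) k) → VAll.All (IsMinCut w) Xs → LinIndep Xs → k ≤ size T
    bound k Xs min indep = unique-⊆⇒≤ (linIndep⇒unique Xs indep) λ i →
      subst (VMem._∈ nodes T) (sym (Vecₚ.lookup-map i away Xs))
        (VMemₚ.∈-toList⁻ (minCut⇒shore (lookup Xs i) (VAllₚ.lookup⁺ min i)))

theorem5p12 : (n : ℕ) → 2 ≤ n → (L : List (Subset n)) → MaximalCrossFree L →
    Complete (weightFn L) × CDim (weightFn L) (2 * n ∸ 3) × MinCutsAre (weightFn L) L
-- With two vertices or more, at least one remains besides the vertex zero, so the tree has a leaf.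
theorem5p12 (suc (suc m)) (s≤s (s≤s z≤n)) L maxL =
  weightFn-pos L , subst (CDim (weightFn L)) (size-⊤ T) (cdim L T L↭T) , minCutsAre L T L↭T
  where
  tree = maximalLaminar⇒tree (crossFree⇒laminar maxL)
  T = proj₁ tree
  L↭T : List.map away L ↭ toList (nodes T)
  -- Both lists are free of repetitions and have the same members.
  L↭T = ∼bag⇒↭ (unique∧set⇒bag (distinct⇒unique (proj₁ maxL)) (nodes-unique T)
    (mk⇔ (proj₂ (proj₂ tree)) (proj₁ (proj₂ tree))))
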